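{- Let $n \geq 2$ and let $\Lambda = \{0, \lambda_2, \ldots, \lambda_n\}$ be a multiset of real numbers with $\lambda_2, \ldots, \lambda_n$ positive. Then $\Lambda$ is Laplacian realizable for the complete graph $K_n$. Moreover, $K_n$ is the only connected graph on $n$ vertices for which every multiset $\Lambda$ of this form is Laplacian realizable.
   Context: Graphs are finite and simple. For a graph $G$ on $n$ vertices, $\mathcal{S}_L(G)$ denotes the set of $n\times n$ real symmetric matrices $A=[a_{i,j}]$ (generalized Laplacian matrices of $G$) such that $a_{i,j}<0$ if $\{i,j\}\in E(G)$, $a_{i,j}=0$ if $i\neq j$ and $\{i,j\}\notin E(G)$, and $a_{i,i}=-\sum_{k\neq i}a_{i,k}$ for all $i$. A multiset $\{0,\lambda_2,\ldots,\lambda_n\}$ of real numbers is Laplacian realizable for $G$ if there is $A\in\mathcal{S}_L(G)$ whose spectrum (multiset of eigenvalues) is $\{0,\lambda_2,\ldots,\lambda_n\}$. -}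

module Defs where

open import Level using (0ℓ; _⊔_) renaming (suc to lsuc)
open import Algebra.Bundles using (CommutativeRing)
import Algebra.Properties.Monoid.Sum as Sum
import Algebra.Properties.Semiring.Exp as Exp
open import Data.Bool.Base using (if_then_else_)
open import Data.Fin.Base using (Fin; zero; suc; toℕ; punchIn)
open import Data.Fin.Properties using (_≟_)
open import Data.List.Base using (List; _∷_; map; foldr)
open import Data.Nat.Base using (ℕ; zero; suc; _∸_)
open import Data.Product.Base using (∃; _×_)
open import Data.Vec.Base using (Vec; toList)
open import Data.Vec.Functional using (Vector)
open import Data.Vec.Relation.Unary.All using (All)
open import Function.Bundles using (_⇔_)
open import Relation.Binary.Core using (Rel)
open import Relation.Binary.Construct.Closure.ReflexiveTransitive using (Star)
open import Relation.Binary.Definitions using (Symmetric; Irreflexive; Decidable)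
open import Relation.Binary.PropositionalEquality.Core using (_≡_; _≢_; ≢-sym)
open import Relation.Binary.Structures using (IsStrictTotalOrder)
open import Relation.Nullary.Decidable.Core using (does; ¬?)
open import Relation.Nullary.Negation.Core using (¬_)
open import Relation.Unary using (Pred)

-- The library has no real numbers.  ℝ is given by its (classical, categorical)
-- axioms: an ordered field, with decidable trichotomy, in which every nonempty
-- predicate that is bounded above has a least upper bound.

record CompleteOrderedField c ℓ : Set (lsuc (c ⊔ ℓ)) where
  infix 4 _<_
  field
    commutativeRing : CommutativeRing c ℓ

  open CommutativeRing commutativeRing public

  field
    _<_                : Rel Carrier ℓ
    isStrictTotalOrder : IsStrictTotalOrder _≈_ _<_
    0≉1                : ¬ (0# ≈ 1#)
    inverse            : ∀ x → ¬ (x ≈ 0#) → ∃ λ y → x * y ≈ 1#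
    +-monoˡ-<          : ∀ {x y} z → x < y → x + z < y + z
    *-pos              : ∀ {x y} → 0# < x → 0# < y → 0# < x * y

  UpperBound : Pred Carrier (c ⊔ ℓ) → Pred Carrier (c ⊔ ℓ)
  UpperBound P u = ∀ x → P x → ¬ (u < x)

  LeastUpperBound : Pred Carrier (c ⊔ ℓ) → Pred Carrier (c ⊔ ℓ)
  LeastUpperBound P s = UpperBound P s × (∀ u → UpperBound P u → ¬ (u < s))

  field
    complete : (P : Pred Carrier (c ⊔ ℓ)) →
               ∃ P → ∃ (UpperBound P) → ∃ (LeastUpperBound P)

record Graph (n : ℕ) : Set₁ where
  field
    Adj        : Rel (Fin n) 0ℓ
    adj?       : Decidable Adj
    adj-sym    : Symmetric Adj
    adj-irrefl : Irreflexive _≡_ Adj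

open Graph

-- Graphs are labelled by Fin n, so equality means having the same edges.  For
-- K n this agrees with isomorphism.
infix 4 _≐_

_≐_ : ∀ {n} → Graph n → Graph n → Set
G ≐ H = ∀ i j → Adj G i j ⇔ Adj H i j

K : ∀ n → Graph n
K n = record
  { Adj        = _≢_
  ; adj?       = λ i j → ¬? (i ≟ j)
  ; adj-sym    = ≢-sym
  ; adj-irrefl = λ i≡j i≢j → i≢j i≡j
  }

Connected : ∀ {n} → Graph n → Set
Connected G = ∀ i j → Star (Adj G) i j

module _ {c ℓ} (ℝ : CompleteOrderedField c ℓ) where

  open CompleteOrderedField ℝ hiding (zero)
  open Sum +-monoid using (sum)
  open Exp semiring using (_^_)

  Matrix : ℕ → Set c
  Matrix n = Vector (Vector Carrier n) n

  identity : ∀ {n} → Matrix n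
  identity i j = if does (i ≟ j) then 1# else 0#

  -- Laplace expansion along the first row.
  det : ∀ {n} → Matrix n → Carrier
  det {zero}  A = 1#
  det {suc n} A = sum λ j →
    (- 1#) ^ toℕ j * A zero j * det (λ i k → A (suc i) (punchIn j k))

  -- As a polynomial function; over an infinite field such as ℝ this determines
  -- the polynomial.
  charPoly : ∀ {n} → Matrix n → Carrier → Carrier
  charPoly A x = det λ i j → x * identity i j - A i j

  -- The list Λ represents a multiset, namely that of the roots of charPoly A,
  -- with multiplicity.  The product does not depend on the order of Λ.
  HasSpectrum : ∀ {n} → Matrix n → List Carrier → Set (c ⊔ ℓ)
  HasSpectrum A Λ = ∀ x → charPoly A x ≈ foldr _*_ 1# (map (λ μ → x - μ) Λ)

  record GeneralizedLaplacian {n} (G : Graph n) (A : Matrix n) : Set ℓ where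
    field
      symmetric : ∀ i j → A i j ≈ A j i
      edge      : ∀ i j → Adj G i j → A i j < 0#
      non-edge  : ∀ i j → i ≢ j → ¬ Adj G i j → A i j ≈ 0#
      diagonal  : ∀ i → A i i ≈ - sum (λ k → if does (k ≟ i) then 0# else A i k)

  LaplacianRealizable : ∀ {n} → Graph n → List Carrier → Set (c ⊔ ℓ)
  LaplacianRealizable G Λ = ∃ λ A → GeneralizedLaplacian G A × HasSpectrum A Λ

  -- The vector lists λ₂, …, λₙ.
  EveryPositiveRealizable : ∀ {n} → Graph n → Set (c ⊔ ℓ)
  EveryPositiveRealizable {n} G =
    (λs : Vec Carrier (n ∸ 1)) → All (0# <_) λs →
    LaplacianRealizable G (0# ∷ toList λs)

{-# OPTIONS --safe #-}

-- Realizability for K n is by induction on n.  Let b be the smallest of the n - 1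
-- prescribed positive numbers divided by n.  If A′ realizes the others, each
-- lowered by b, then bordering A′ + bI by a row and a column of entries -b (and
-- the corner (n - 1)b) replaces 0 by the eigenvalues 0 and nb and raises every
-- other eigenvalue by b.  To avoid dividing characteristic polynomials by x, the
-- induction tracks the determinant of xI - A with its first column replaced by
-- ones, which is det(xI - A) / x when the rows of A sum to 0.
--
-- Conversely, let A realize {0, n, …, n}.  The expansion of det(I - tA) up to
-- order 2 at t = 0 determines tr A and tr A², hence the sum of the squares of the
-- entries of A - (nI - J), where J is the all-ones matrix; that sum is 0.  So
-- A = nI - J has no zero entry off the diagonal.

module Submission where

open import Defs
open import Algebra.Bundles using (CommutativeRing)
import Algebra.Properties.CommutativeMonoid.Sum as CommutativeMonoidSum
import Algebra.Properties.Ring as RingProperties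
import Algebra.Properties.Semiring.Exp as SemiringExp
import Algebra.Properties.Semiring.Mult.TCOptimised as Mult
import Algebra.Properties.Semiring.Sum as SemiringSum
import Algebra.Solver.Ring as RingSolver
open import Algebra.Solver.Ring.AlmostCommutativeRing using (_-Raw-AlmostCommutative⟶_; fromCommutativeRing)
open import Data.Bool.Base using (if_then_else_)
open import Data.Fin.Base using (Fin; zero; suc; toℕ; punchIn)
open import Data.Fin.Properties using (_≟_)
open import Data.Integer.Base as ℤ using (ℤ; +_; -[1+_])
import Data.Integer.Properties as ℤ
open import Data.List.Base as List using (List; _∷_; [])
open import Data.List.Relation.Unary.All as ListAll using (_∷_; [])
open import Data.Maybe.Base using (Maybe; map)
open import Data.Nat.Base as ℕ using (ℕ; zero; suc; _≤_)
import Data.Nat.Properties as ℕ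
open import Data.Product.Base using (_×_; _,_; ∃; proj₁; proj₂)
open import Data.Sum.Base using (_⊎_; inj₁; inj₂)
open import Data.Vec.Base as Vec using (Vec; _∷_; [])
open import Data.Vec.Functional using (Vector)
import Data.Vec.Properties as Vec
import Data.Vec.Relation.Unary.All.Properties as All
open import Function.Base using (_∘_)
open import Function.Bundles using (_⇔_; mk⇔; Equivalence)
open import Level using (_⊔_)
open import Relation.Binary.Construct.Closure.ReflexiveTransitive using (ε; _◅_)
open import Relation.Binary.Definitions using (tri<; tri≈; tri>)
open import Relation.Binary.PropositionalEquality.Core as ≡ using (_≡_; _≢_)
open import Relation.Binary.Structures using (IsStrictTotalOrder)
open import Relation.Nullary.Decidable.Core using (does; yes; no; dec⇒maybe)
open import Relation.Nullary.Negation.Core using (¬_; contradiction)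

-- Ring solving with integer coefficients in an arbitrary commutative ring.

module IntegerSolver {c ℓ} (R : CommutativeRing c ℓ) where

  open CommutativeRing R
  open RingProperties ring
  open Mult semiring using (1+×) renaming (_×_ to _·_; ×-homo-+ to ·-homo-+; ×1-homo-* to ·1-homo-*)
  open import Relation.Binary.Reasoning.Setoid setoid

  -- The multiple `1 · 1#` computes to `1#`, so the solver's constants `:0` and `:1` stand literally
  -- for `0#` and `1#`.
  ⟦_⟧ : ℤ → Carrier
  ⟦ + n ⟧      = n · 1#
  ⟦ -[1+ n ] ⟧ = - (suc n · 1#)

  ⊖-homo : ∀ m n → ⟦ m ℤ.⊖ n ⟧ ≈ m · 1# - n · 1#
  ⊖-homo m zero = begin
    ⟦ m ℤ.⊖ 0 ⟧       ≡⟨ ≡.cong ⟦_⟧ (ℤ.⊖-≥ {m} {0} ℕ.z≤n) ⟩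
    m · 1#            ≈⟨ +-identityʳ _ ⟨
    m · 1# + 0#       ≈⟨ +-congˡ -0#≈0# ⟨
    m · 1# - 0 · 1#   ∎
  ⊖-homo zero (suc n) = sym (+-identityˡ _)
  ⊖-homo (suc m) (suc n) = begin
    ⟦ suc m ℤ.⊖ suc n ⟧               ≡⟨ ≡.cong ⟦_⟧ (ℤ.[1+m]⊖[1+n]≡m⊖n m n) ⟩
    ⟦ m ℤ.⊖ n ⟧                       ≈⟨ ⊖-homo m n ⟩
    m · 1# - n · 1#                   ≈⟨ +-congʳ (+-identityʳ _) ⟨
    -- A cancelling pair is inserted here, and its two halves turn `m` and `n` into their
    -- successors.
    m · 1# + 0# - n · 1#              ≈⟨ +-congʳ (+-congˡ (-‿inverseʳ 1#)) ⟨
    m · 1# + (1# - 1#) - n · 1#       ≈⟨ +-congʳ (+-assoc _ _ _) ⟨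
    m · 1# + 1# - 1# - n · 1#         ≈⟨ +-congʳ (+-congʳ (+-comm _ _)) ⟩
    1# + m · 1# - 1# - n · 1#         ≈⟨ +-assoc _ _ _ ⟩
    1# + m · 1# + (- 1# - n · 1#)     ≈⟨ +-congˡ (-‿+-comm _ _) ⟩
    1# + m · 1# - (1# + n · 1#)       ≈⟨ +-cong (1+× m 1#) (-‿cong (1+× n 1#)) ⟨
    suc m · 1# - suc n · 1#           ∎

  +-homo : ∀ i j → ⟦ i ℤ.+ j ⟧ ≈ ⟦ i ⟧ + ⟦ j ⟧
  +-homo (+ m)      (+ n)      = ·-homo-+ 1# m n
  +-homo (+ m)      (-[1+ n ]) = ⊖-homo m (suc n)
  +-homo (-[1+ m ]) (+ n)      = trans (⊖-homo n (suc m)) (+-comm _ _)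
  +-homo (-[1+ m ]) (-[1+ n ]) = begin
    - (suc (suc (m ℕ.+ n)) · 1#)       ≡⟨ ≡.cong (λ k → - (k · 1#)) (ℕ.+-suc (suc m) n) ⟨
    - ((suc m ℕ.+ suc n) · 1#)         ≈⟨ -‿cong (·-homo-+ 1# (suc m) (suc n)) ⟩
    - (suc m · 1# + suc n · 1#)        ≈⟨ -‿+-comm _ _ ⟨
    - (suc m · 1#) - suc n · 1#        ∎

  *-homo : ∀ i j → ⟦ i ℤ.* j ⟧ ≈ ⟦ i ⟧ * ⟦ j ⟧
  *-homo (+ m) (+ n) = begin
    ⟦ + m ℤ.* + n ⟧    ≡⟨ ≡.cong ⟦_⟧ (ℤ.pos-* m n) ⟨
    (m ℕ.* n) · 1#     ≈⟨ ·1-homo-* m n ⟩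
    m · 1# * n · 1#    ∎
  *-homo (+ zero) (-[1+ n ]) = sym (zeroˡ _)
  *-homo (+ suc m) (-[1+ n ]) = trans (-‿cong (·1-homo-* (suc m) (suc n))) (-‿distribʳ-* _ _)
  *-homo (-[1+ m ]) (+ zero) = begin
    ⟦ -[1+ m ] ℤ.* + 0 ⟧ ≡⟨ ≡.cong ⟦_⟧ (ℤ.*-zeroʳ -[1+ m ]) ⟩
    0#                   ≈⟨ zeroʳ _ ⟨
    ⟦ -[1+ m ] ⟧ * 0#    ∎
  *-homo (-[1+ m ]) (+ suc n) = trans (-‿cong (·1-homo-* (suc m) (suc n))) (-‿distribˡ-* _ _)
  *-homo (-[1+ m ]) (-[1+ n ]) = begin
    (suc m ℕ.* suc n) · 1#            ≈⟨ ·1-homo-* (suc m) (suc n) ⟩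
    suc m · 1# * suc n · 1#           ≈⟨ -‿involutive _ ⟨
    - - (suc m · 1# * suc n · 1#)     ≈⟨ -‿cong (-‿distribʳ-* _ _) ⟩
    - (suc m · 1# * - (suc n · 1#))   ≈⟨ -‿distribˡ-* _ _ ⟩
    - (suc m · 1#) * - (suc n · 1#)   ∎

  -‿homo : ∀ i → ⟦ ℤ.- i ⟧ ≈ - ⟦ i ⟧
  -‿homo (+ zero)   = sym -0#≈0#
  -‿homo (+ suc n)  = refl
  -‿homo (-[1+ n ]) = sym (-‿involutive _)

  homomorphism : ℤ.+-*-rawRing -Raw-AlmostCommutative⟶ fromCommutativeRing R
  homomorphism = record
    { ⟦_⟧    = ⟦_⟧
    ; +-homo = +-homo
    ; *-homo = *-homo
    ; -‿homo = -‿homo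
    ; 0-homo = refl
    ; 1-homo = refl
    }

  ⟦⟧-≟ : ∀ i j → Maybe (⟦ i ⟧ ≈ ⟦ j ⟧)
  ⟦⟧-≟ i j = map (reflexive ∘ ≡.cong ⟦_⟧) (dec⇒maybe (i ℤ.≟ j))

  open RingSolver ℤ.+-*-rawRing (fromCommutativeRing R) homomorphism ⟦⟧-≟ public
    using (solve; _:=_; _:+_; _:*_; :-_; _:-_; con; Polynomial)

  :0 :1 : ∀ {n} → Polynomial n
  :0 = con (+ 0)
  :1 = con (+ 1)

-- Column indices under the deletion of two columns.

slide : ∀ {n} → Fin (suc n) → Fin n → Fin n
slide zero    zero    = zero
slide zero    (suc k) = zero
slide (suc j) zero    = j
slide (suc j) (suc k) = suc (slide j k)

-- So `slide j k` is where column `j` stands once column `punchIn j k` has been deleted. Writing the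
-- deleted column as `punchIn j k` builds in that it differs from `j`.
punchIn-slide : ∀ {n} (j : Fin (suc n)) (k : Fin n) → punchIn (punchIn j k) (slide j k) ≡ j
punchIn-slide zero    zero    = ≡.refl
punchIn-slide zero    (suc k) = ≡.refl
punchIn-slide (suc j) zero    = ≡.refl
punchIn-slide (suc j) (suc k) = ≡.cong suc (punchIn-slide j k)

-- Both sides skip the columns `j` and `punchIn j k`, deleted in opposite orders, so two successive
-- deletions leave the same minor either way.
punchIn-punchIn-slide : ∀ {n} (j : Fin (suc (suc n))) (k : Fin (suc n)) (r : Fin n) →
                        punchIn (punchIn j k) (punchIn (slide j k) r) ≡ punchIn j (punchIn k r)
punchIn-punchIn-slide zero    zero    r       = ≡.refl
punchIn-punchIn-slide zero    (suc k) r       = ≡.refl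
punchIn-punchIn-slide (suc j) zero    r       = ≡.refl
punchIn-punchIn-slide (suc j) (suc k) zero    = ≡.refl
punchIn-punchIn-slide (suc j) (suc k) (suc r) = ≡.cong suc (punchIn-punchIn-slide j k r)

-- Determinants from the expansion along the first row.

module Determinants {a ℓ} (ℝ : CompleteOrderedField a ℓ) where

  open CompleteOrderedField ℝ hiding (zero; _<_)
  private
    module S = SemiringSum semiring
    module P = CommutativeMonoidSum *-commutativeMonoid
  open SemiringExp semiring using (_^_)
  open IntegerSolver commutativeRing
  open import Relation.Binary.Reasoning.Setoid setoid

  sgn : ∀ {n} → Fin n → Carrier
  sgn j = (- 1#) ^ toℕ j

  sgn² : ∀ {n} (j : Fin n) → sgn j * sgn j ≈ 1#
  sgn² zero    = *-identityˡ 1#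
  sgn² (suc j) = trans
    (solve 1 (λ s → (:- :1 :* s) :* (:- :1 :* s) := s :* s) refl (sgn j)) (sgn² j)

  -- Taking out the columns `j` and `punchIn j k` in the two possible orders gives opposite signs.
  -- The four signs are distributed here as they occur in `Det-front`.
  sgn-slide : ∀ {n} (j : Fin (suc n)) (k : Fin n) →
              - 1# * sgn k * sgn (slide j k) ≈ sgn j * sgn (punchIn j k)
  sgn-slide zero    zero    = solve 0 (:- :1 :* :1 :* :1 := :1 :* (:- :1 :* :1)) refl
  sgn-slide zero    (suc k) = solve 1 (λ s → :- :1 :* s :* :1 := :1 :* (:- :1 :* s)) refl (- 1# * sgn k)
  sgn-slide (suc j) zero    = solve 1 (λ s → :- :1 :* :1 :* s := :- :1 :* s :* :1) refl (sgn j)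
  sgn-slide (suc j) (suc k) = begin
    - 1# * (- 1# * sgn k) * (- 1# * sgn (slide j k))
      ≈⟨ solve 2 (λ s t → :- :1 :* (:- :1 :* s) :* (:- :1 :* t) := :- :1 :* s :* t)
           refl (sgn k) (sgn (slide j k)) ⟩
    - 1# * sgn k * sgn (slide j k)
      ≈⟨ sgn-slide j k ⟩
    sgn j * sgn (punchIn j k)
      ≈⟨ solve 2 (λ s t → s :* t := (:- :1 :* s) :* (:- :1 :* t)) refl (sgn j) (sgn (punchIn j k)) ⟩
    - 1# * sgn j * (- 1# * sgn (punchIn j k)) ∎

  -- Opaque so that unification does not unfold them at successor sizes.
  opaque

    ∑ : ∀ {n} → Vector Carrier n → Carrier
    ∑ = S.sum

    sum≡∑ : ∀ {n} (f : Vector Carrier n) → S.sum f ≡ ∑ f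
    sum≡∑ f = ≡.refl

    ∑-empty : (f : Vector Carrier 0) → ∑ f ≈ 0#
    ∑-empty f = refl

    ∑-suc : ∀ {n} (f : Vector Carrier (suc n)) → ∑ f ≈ f zero + ∑ (f ∘ suc)
    ∑-suc f = refl

    ∑-cong : ∀ {n} {f g : Vector Carrier n} → (∀ i → f i ≈ g i) → ∑ f ≈ ∑ g
    ∑-cong = S.sum-cong-≋

    ∑-distrib-+ : ∀ {n} (f g : Vector Carrier n) → ∑ (λ i → f i + g i) ≈ ∑ f + ∑ g
    ∑-distrib-+ = S.∑-distrib-+

    *-distribˡ-∑ : ∀ {n} x (f : Vector Carrier n) → x * ∑ f ≈ ∑ (λ i → x * f i)
    *-distribˡ-∑ = S.*-distribˡ-sum

    ∑-remove : ∀ {n} (i : Fin (suc n)) (f : Vector Carrier (suc n)) → ∑ f ≈ f i + ∑ (f ∘ punchIn i)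
    ∑-remove i f = S.sum-remove {i = i} f

    ∏ : ∀ {n} → Vector Carrier n → Carrier
    ∏ = P.sum

    ∏-empty : (f : Vector Carrier 0) → ∏ f ≈ 1#
    ∏-empty f = refl

    ∏-suc : ∀ {n} (f : Vector Carrier (suc n)) → ∏ f ≈ f zero * ∏ (f ∘ suc)
    ∏-suc f = refl

    ∏-cong : ∀ {n} {f g : Vector Carrier n} → (∀ i → f i ≈ g i) → ∏ f ≈ ∏ g
    ∏-cong = P.sum-cong-≋

    ∏-remove : ∀ {n} (i : Fin (suc n)) (f : Vector Carrier (suc n)) → ∏ f ≈ f i * ∏ (f ∘ punchIn i)
    ∏-remove i f = P.sum-remove {i = i} f

    Det : ∀ {n} → Matrix ℝ n → Carrier
    Det = det ℝ

    det≡Det : ∀ {n} (A : Matrix ℝ n) → det ℝ A ≡ Det A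
    det≡Det A = ≡.refl

    Det-empty : (A : Matrix ℝ 0) → Det A ≈ 1#
    Det-empty A = refl

    Det-suc : ∀ {n} (A : Matrix ℝ (suc n)) →
              Det A ≈ ∑ (λ j → sgn j * A zero j * Det (λ i k → A (suc i) (punchIn j k)))
    Det-suc A = refl

  ∑-zero : ∀ {n} {f : Vector Carrier n} → (∀ i → f i ≈ 0#) → ∑ f ≈ 0#
  ∑-zero {zero}  f≈0 = ∑-empty _
  ∑-zero {suc n} f≈0 = trans (∑-suc _) (trans (+-cong (f≈0 zero) (∑-zero (f≈0 ∘ suc))) (+-identityˡ 0#))

  Det-cong : ∀ {n} {A B : Matrix ℝ n} → (∀ i j → A i j ≈ B i j) → Det A ≈ Det B
  Det-cong {zero}  A≈B = trans (Det-empty _) (sym (Det-empty _))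
  Det-cong {suc n} {A} {B} A≈B = begin
    Det A ≈⟨ Det-suc A ⟩
    ∑ (λ j → sgn j * A zero j * Det (λ i k → A (suc i) (punchIn j k)))
      ≈⟨ ∑-cong (λ j → *-cong (*-congˡ (A≈B zero j)) (Det-cong λ i k → A≈B (suc i) (punchIn j k))) ⟩
    ∑ (λ j → sgn j * B zero j * Det (λ i k → B (suc i) (punchIn j k)))
      ≈⟨ Det-suc B ⟨
    Det B ∎

  Det-scale : ∀ {n} x (A : Matrix ℝ n) → Det (λ i j → x * A i j) ≈ x ^ n * Det A
  Det-scale {zero}  x A = trans (Det-empty _) (sym (trans (*-identityˡ _) (Det-empty A)))
  Det-scale {suc n} x A = begin
    Det (λ i j → x * A i j)
      ≈⟨ Det-suc _ ⟩
    ∑ (λ j → sgn j * (x * A zero j) * Det (λ i k → x * A (suc i) (punchIn j k)))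
      ≈⟨ ∑-cong (λ j → trans (*-congˡ (Det-scale x (minor j)))
           (solve 5 (λ s x a p d → s :* (x :* a) :* (p :* d) := x :* p :* (s :* a :* d)) refl
             (sgn j) x (A zero j) (x ^ n) (Det (minor j)))) ⟩
    ∑ (λ j → x * x ^ n * (sgn j * A zero j * Det (minor j)))
      ≈⟨ *-distribˡ-∑ (x * x ^ n) (λ j → sgn j * A zero j * Det (minor j)) ⟨
    x ^ suc n * ∑ (λ j → sgn j * A zero j * Det (minor j))
      ≈⟨ *-congˡ (Det-suc A) ⟨
    x ^ suc n * Det A ∎
    where
    minor : Fin (suc n) → Matrix ℝ n
    minor j i k = A (suc i) (punchIn j k)

  -- The determinant as a linear and alternating function of the first column.

  infix 5 _∣_
  -- Column operations are carried out on the first column only, which this notation isolates;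
  -- `Det-front` brings any other column there.
  _∣_ : ∀ {n m} → Vector Carrier n → (Fin n → Fin m → Carrier) → Fin n → Fin (suc m) → Carrier
  (v ∣ W) i zero    = v i
  (v ∣ W) i (suc j) = W i j

  delete : ∀ {n m} → Fin (suc m) → (Fin n → Fin (suc m) → Carrier) → Fin n → Fin m → Carrier
  delete j W i k = W i (punchIn j k)

  Det-∣-cong : ∀ {n} {u v : Vector Carrier (suc n)} {V W : Fin (suc n) → Fin n → Carrier} →
               (∀ i → u i ≈ v i) → (∀ i j → V i j ≈ W i j) → Det (u ∣ V) ≈ Det (v ∣ W)
  Det-∣-cong u≈v V≈W = Det-cong λ where
    i zero    → u≈v i
    i (suc j) → V≈W i j

  -- Every minor in the sum again has the rest of `v` as its first column, so induction on the size
  -- can proceed. The factor `- 1# * sgn j` is `sgn (suc j)`.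
  Det-expand : ∀ {n} (v : Vector Carrier (suc (suc n))) W → Det (v ∣ W) ≈
    v zero * Det (W ∘ suc) +
    ∑ (λ j → - 1# * sgn j * W zero j * Det (v ∘ suc ∣ delete j (W ∘ suc)))
  Det-expand v W = begin
    Det (v ∣ W)
      ≈⟨ trans (Det-suc _) (∑-suc _) ⟩
    1# * v zero * Det (W ∘ suc) + ∑ (λ j → - 1# * sgn j * W zero j * Det (λ i k → (v ∣ W) (suc i) (punchIn (suc j) k)))
      ≈⟨ +-cong (*-congʳ (*-identityˡ _)) (∑-cong λ j → *-congˡ (Det-cong λ where
           i zero    → refl
           i (suc k) → refl)) ⟩
    v zero * Det (W ∘ suc) + ∑ (λ j → - 1# * sgn j * W zero j * Det (v ∘ suc ∣ delete j (W ∘ suc))) ∎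

  Det-1×1 : (A : Matrix ℝ 1) → Det A ≈ A zero zero
  Det-1×1 A = begin
    Det A ≈⟨ trans (Det-suc A) (trans (∑-suc _) (+-cong (*-congˡ (Det-empty _)) (∑-empty _))) ⟩
    1# * A zero zero * 1# + 0# ≈⟨ solve 1 (λ a → :1 :* a :* :1 :+ :0 := a) refl _ ⟩
    A zero zero ∎

  Det-linear : ∀ {n} x (u v : Vector Carrier (suc n)) W →
               Det ((λ i → u i + x * v i) ∣ W) ≈ Det (u ∣ W) + x * Det (v ∣ W)
  Det-linear {zero} x u v W =
    trans (Det-1×1 _) (sym (+-cong (Det-1×1 (u ∣ W)) (*-congˡ (Det-1×1 (v ∣ W)))))
  Det-linear {suc n} x u v W = begin
    Det ((λ i → u i + x * v i) ∣ W)
      ≈⟨ Det-expand _ W ⟩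
    (u zero + x * v zero) * D + ∑ (λ j → c j * Det ((λ i → u (suc i) + x * v (suc i)) ∣ W′ j))
      ≈⟨ +-congˡ (∑-cong λ j → trans
           (*-congˡ (Det-linear x (u ∘ suc) (v ∘ suc) (W′ j)))
           (solve 4 (λ c p x q → c :* (p :+ x :* q) := c :* p :+ x :* (c :* q)) refl (c j) _ x _)) ⟩
    (u zero + x * v zero) * D + ∑ (λ j → U j + x * V j)
      ≈⟨ +-congˡ (trans (∑-distrib-+ U _) (+-congˡ (sym (*-distribˡ-∑ x V)))) ⟩
    (u zero + x * v zero) * D + (∑ U + x * ∑ V)
      ≈⟨ solve 6 (λ u x v d p q → (u :+ x :* v) :* d :+ (p :+ x :* q) := (u :* d :+ p) :+ x :* (v :* d :+ q))
           refl (u zero) x (v zero) D (∑ U) (∑ V) ⟩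
    (u zero * D + ∑ U) + x * (v zero * D + ∑ V)
      ≈⟨ +-cong (Det-expand u W) (*-congˡ (Det-expand v W)) ⟨
    Det (u ∣ W) + x * Det (v ∣ W) ∎
    where
    D = Det (W ∘ suc)
    c = λ j → - 1# * sgn j * W zero j
    W′ = λ j → delete j (W ∘ suc)
    U = λ j → c j * Det (u ∘ suc ∣ W′ j)
    V = λ j → c j * Det (v ∘ suc ∣ W′ j)

  -- The zero column is itself minus itself, so by linearity the determinant is also itself minus
  -- itself.
  Det-0∣ : ∀ {n} (W : Fin (suc n) → Fin n → Carrier) → Det ((λ _ → 0#) ∣ W) ≈ 0#
  Det-0∣ W = begin
    Det (0ᵛ ∣ W)
      ≈⟨ Det-∣-cong (λ _ → solve 0 (:0 := :0 :+ :- :1 :* :0) refl) (λ _ _ → refl) ⟩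
    Det ((λ _ → 0# + - 1# * 0#) ∣ W)
      ≈⟨ Det-linear (- 1#) 0ᵛ 0ᵛ W ⟩
    Det (0ᵛ ∣ W) + - 1# * Det (0ᵛ ∣ W)
      ≈⟨ solve 1 (λ d → d :+ :- :1 :* d := :0) refl _ ⟩
    0# ∎
    where 0ᵛ = λ _ → 0#

  Det-scale∣ : ∀ {n} x (v : Vector Carrier (suc n)) W →
               Det ((λ i → x * v i) ∣ W) ≈ x * Det (v ∣ W)
  Det-scale∣ x v W = begin
    Det ((λ i → x * v i) ∣ W)                      ≈⟨ Det-∣-cong (λ i → sym (+-identityˡ _)) (λ _ _ → refl) ⟩
    Det ((λ i → 0# + x * v i) ∣ W)                 ≈⟨ Det-linear x (λ _ → 0#) v W ⟩
    Det ((λ _ → 0#) ∣ W) + x * Det (v ∣ W)       ≈⟨ +-congʳ (Det-0∣ W) ⟩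
    0# + x * Det (v ∣ W)                           ≈⟨ +-identityˡ _ ⟩
    x * Det (v ∣ W)                                ∎

  Det-sum∣ : ∀ {p n} (x : Vector Carrier p) (V : Fin (suc n) → Fin p → Carrier) W →
             Det ((λ i → ∑ (λ k → x k * V i k)) ∣ W) ≈ ∑ (λ k → x k * Det ((λ i → V i k) ∣ W))
  Det-sum∣ {p = zero}  x V W =
    trans (Det-∣-cong (λ _ → ∑-empty _) (λ _ _ → refl)) (trans (Det-0∣ W) (sym (∑-empty _)))
  Det-sum∣ {p = suc p} x V W = begin
    Det ((λ i → ∑ (λ k → x k * V i k)) ∣ W)
      ≈⟨ Det-∣-cong (λ i → trans (∑-suc _) (+-comm _ _)) (λ _ _ → refl) ⟩
    Det ((λ i → S i + x zero * V i zero) ∣ W)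
      ≈⟨ Det-linear (x zero) S (λ i → V i zero) W ⟩
    Det (S ∣ W) + x zero * Det ((λ i → V i zero) ∣ W)
      ≈⟨ +-congʳ (Det-sum∣ (x ∘ suc) (λ i → V i ∘ suc) W) ⟩
    ∑ (λ k → x (suc k) * Det ((λ i → V i (suc k)) ∣ W)) + x zero * Det ((λ i → V i zero) ∣ W)
      ≈⟨ trans (∑-suc _) (+-comm _ _) ⟨
    ∑ (λ k → x k * Det ((λ i → V i k) ∣ W)) ∎
    where S = λ i → ∑ (λ k → x (suc k) * V i (suc k))

  -- The move amounts to `toℕ j` adjacent transpositions. The proof expands along the first row:
  -- deleting column `punchIn j k` leaves column `j` at position `slide j k` of the minor, where
  -- induction applies, and `sgn-slide` matches the signs.
  Det-front : ∀ {n} (j : Fin (suc n)) (W : Matrix ℝ (suc n)) →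
              Det ((λ i → W i j) ∣ delete j W) ≈ sgn j * Det W
  Det-front {zero} zero W =
    trans (Det-1×1 _) (sym (trans (*-identityˡ _) (Det-1×1 W)))
  Det-front {suc n} j W = begin
    Det ((λ i → W i j) ∣ delete j W)
      ≈⟨ Det-expand (λ i → W i j) (delete j W) ⟩
    W zero j * D j + ∑ (λ k → - 1# * sgn k * W zero (punchIn j k) *
                                Det ((λ i → W (suc i) j) ∣ delete k (delete j (W ∘ suc))))
      ≈⟨ +-cong head-term (∑-cong tail-term) ⟩
    sgn j * T j + ∑ (λ k → sgn j * T (punchIn j k))
      ≈⟨ +-congˡ (*-distribˡ-∑ (sgn j) (λ k → T (punchIn j k))) ⟨
    sgn j * T j + sgn j * ∑ (λ k → T (punchIn j k))
      ≈⟨ distribˡ _ _ _ ⟨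
    sgn j * (T j + ∑ (λ k → T (punchIn j k)))
      ≈⟨ *-congˡ (trans (Det-suc W) (∑-remove j T)) ⟨
    sgn j * Det W ∎
    where
    D T : Fin (suc (suc n)) → Carrier
    D l = Det (delete l (W ∘ suc))
    T l = sgn l * W zero l * D l

    head-term : W zero j * D j ≈ sgn j * T j
    head-term = begin
      W zero j * D j                     ≈⟨ *-identityˡ _ ⟨
      1# * (W zero j * D j)              ≈⟨ *-congʳ (sgn² j) ⟨
      sgn j * sgn j * (W zero j * D j)   ≈⟨ solve 3 (λ s w d → s :* s :* (w :* d) := s :* (s :* w :* d)) refl (sgn j) (W zero j) (D j) ⟩
      sgn j * T j                        ∎

    tail-term : ∀ k → - 1# * sgn k * W zero (punchIn j k) *
                      Det ((λ i → W (suc i) j) ∣ delete k (delete j (W ∘ suc))) ≈ sgn j * T (punchIn j k)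
    tail-term k = begin
      - 1# * sgn k * W zero l * Det ((λ i → W (suc i) j) ∣ delete k (delete j (W ∘ suc)))
        -- The same minor, now read as deleting column `l` first and moving column `j` to the front
        -- afterwards.
        ≈⟨ *-congˡ (Det-∣-cong
             (λ i → reflexive (≡.cong (W (suc i)) (≡.sym (punchIn-slide j k))))
             (λ i r → reflexive (≡.cong (W (suc i)) (≡.sym (punchIn-punchIn-slide j k r))))) ⟩
      - 1# * sgn k * W zero l * Det ((λ i → delete l (W ∘ suc) i (slide j k)) ∣ delete (slide j k) (delete l (W ∘ suc)))
        ≈⟨ *-congˡ (Det-front (slide j k) (delete l (W ∘ suc))) ⟩
      - 1# * sgn k * W zero l * (sgn (slide j k) * D l)
        ≈⟨ solve 4 (λ s w t d → :- :1 :* s :* w :* (t :* d) := :- :1 :* s :* t :* (w :* d))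
             refl (sgn k) (W zero l) (sgn (slide j k)) (D l) ⟩
      - 1# * sgn k * sgn (slide j k) * (W zero l * D l)
        ≈⟨ *-congʳ (sgn-slide j k) ⟩
      sgn j * sgn l * (W zero l * D l)
        ≈⟨ solve 4 (λ s t w d → s :* t :* (w :* d) := s :* (t :* w :* d))
             refl (sgn j) (sgn l) (W zero l) (D l) ⟩
      sgn j * T l ∎
      where l = punchIn j k

  -- In the expansion along the first row, the term deleting the copy of column `j` inside `W`
  -- cancels the leading term by `Det-front`. In all other minors the repetition survives, at
  -- position `slide j k`, and induction applies.
  Det-repeat : ∀ {n} (j : Fin n) (W : Fin (suc n) → Fin n → Carrier) →
               Det ((λ i → W i j) ∣ W) ≈ 0#
  Det-repeat {suc n} j W = begin
    Det ((λ i → W i j) ∣ W)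
      ≈⟨ Det-expand (λ i → W i j) W ⟩
    W zero j * Det (W ∘ suc) + ∑ T
      ≈⟨ +-congˡ (∑-remove j T) ⟩
    W zero j * Det (W ∘ suc) + (T j + ∑ (T ∘ punchIn j))
      ≈⟨ +-congˡ (+-cong diagonal-term (∑-zero (off-diagonal n j W))) ⟩
    W zero j * Det (W ∘ suc) + (- (W zero j * Det (W ∘ suc)) + 0#)
      ≈⟨ solve 1 (λ x → x :+ (:- x :+ :0) := :0) refl _ ⟩
    0# ∎
    where
    term : ∀ {n} (j : Fin (suc n)) (W : Fin (suc (suc n)) → Fin (suc n) → Carrier) → Fin (suc n) → Carrier
    term j W k = - 1# * sgn k * W zero k * Det ((λ i → W (suc i) j) ∣ delete k (W ∘ suc))

    T = term j W

    diagonal-term : T j ≈ - (W zero j * Det (W ∘ suc))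
    diagonal-term = begin
      - 1# * sgn j * W zero j * Det ((λ i → W (suc i) j) ∣ delete j (W ∘ suc))
        ≈⟨ *-congˡ (Det-front j (W ∘ suc)) ⟩
      - 1# * sgn j * W zero j * (sgn j * Det (W ∘ suc))
        ≈⟨ solve 3 (λ s w d → :- :1 :* s :* w :* (s :* d) := s :* s :* (:- (w :* d)))
             refl (sgn j) (W zero j) (Det (W ∘ suc)) ⟩
      sgn j * sgn j * - (W zero j * Det (W ∘ suc))
        ≈⟨ *-congʳ (sgn² j) ⟩
      1# * - (W zero j * Det (W ∘ suc))
        ≈⟨ *-identityˡ _ ⟩
      - (W zero j * Det (W ∘ suc)) ∎

    off-diagonal : ∀ n (j : Fin (suc n)) (W : Fin (suc (suc n)) → Fin (suc n) → Carrier) k →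
                   term j W (punchIn j k) ≈ 0#
    off-diagonal n j W k = begin
      - 1# * sgn l * W zero l * Det ((λ i → W (suc i) j) ∣ delete l (W ∘ suc))
        ≈⟨ *-congˡ (Det-∣-cong
             (λ i → reflexive (≡.cong (W (suc i)) (≡.sym (punchIn-slide j k)))) (λ _ _ → refl)) ⟩
      - 1# * sgn l * W zero l * Det ((λ i → delete l (W ∘ suc) i (slide j k)) ∣ delete l (W ∘ suc))
        ≈⟨ *-congˡ (Det-repeat (slide j k) (delete l (W ∘ suc))) ⟩
      - 1# * sgn l * W zero l * 0#
        ≈⟨ zeroʳ _ ⟩
      0# ∎
      where l = punchIn j k

  -- By linearity the added combination contributes only determinants with a repeated column.
  Det-colAdd : ∀ {n} (u : Vector Carrier (suc n)) (x : Vector Carrier n) W →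
               Det ((λ i → u i + ∑ (λ k → x k * W i k)) ∣ W) ≈ Det (u ∣ W)
  Det-colAdd {n} u x W = begin
    Det ((λ i → u i + S i) ∣ W)
      ≈⟨ Det-∣-cong (λ i → +-congˡ (sym (*-identityˡ _))) (λ _ _ → refl) ⟩
    Det ((λ i → u i + 1# * S i) ∣ W)
      ≈⟨ Det-linear 1# u S W ⟩
    Det (u ∣ W) + 1# * Det (S ∣ W)
      ≈⟨ +-congˡ (*-congˡ (trans (Det-sum∣ x W W) (∑-zero λ k →
           trans (*-congˡ (Det-repeat k W)) (zeroʳ _)))) ⟩
    Det (u ∣ W) + 1# * 0#
      ≈⟨ solve 1 (λ d → d :+ :1 :* :0 := d) refl _ ⟩
    Det (u ∣ W) ∎
    where S = λ i → ∑ (λ k → x k * W i k)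

-- Ordered field arithmetic and sums of nonnegative terms.

module Order {a ℓ} (ℝ : CompleteOrderedField a ℓ) where

  open CompleteOrderedField ℝ hiding (zero)
  open IsStrictTotalOrder isStrictTotalOrder public
    using (compare)
    renaming (trans to <-trans; irrefl to <-irrefl; <-respˡ-≈ to <-respˡ; <-respʳ-≈ to <-respʳ)
  open Determinants ℝ
  open RingProperties ring
  open IntegerSolver commutativeRing

  <⇒0<- : ∀ {x y} → x < y → 0# < y - x
  <⇒0<- {x} {y} x<y = <-respˡ (-‿inverseʳ x) (+-monoˡ-< (- x) x<y)

  0<-⇒< : ∀ {x y} → 0# < y - x → x < y
  0<-⇒< {x} {y} 0<y-x = <-respˡ (+-identityˡ x)
    (<-respʳ (solve 2 (λ x y → y :- x :+ x := y) refl x y) (+-monoˡ-< x 0<y-x))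

  neg-mono-< : ∀ {x y} → x < y → - y < - x
  neg-mono-< {x} {y} x<y = 0<-⇒<
    (<-respʳ (solve 2 (λ x y → y :- x := :- x :- (:- y)) refl x y) (<⇒0<- x<y))

  0<⇒-<0 : ∀ {x} → 0# < x → - x < 0#
  0<⇒-<0 0<x = <-respʳ -0#≈0# (neg-mono-< 0<x)

  <0⇒0<- : ∀ {x} → x < 0# → 0# < - x
  <0⇒0<- x<0 = <-respˡ -0#≈0# (neg-mono-< x<0)

  +-pos : ∀ {x y} → 0# < x → 0# < y → 0# < x + y
  +-pos {x} {y} 0<x 0<y = <-trans 0<y (<-respˡ (+-identityˡ y) (+-monoˡ-< y 0<x))

  square-pos : ∀ {x} → ¬ (x ≈ 0#) → 0# < x * x
  square-pos {x} x≉0 with compare x 0#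
  ... | tri< x<0 _ _ = <-respʳ (solve 1 (λ x → (:- x) :* (:- x) := x :* x) refl x)
                         (*-pos (<0⇒0<- x<0) (<0⇒0<- x<0))
  ... | tri≈ _ x≈0 _ = contradiction x≈0 x≉0
  ... | tri> _ _ 0<x = *-pos 0<x 0<x

  0<1 : 0# < 1#
  0<1 = <-respʳ (*-identityˡ 1#) (square-pos (0≉1 ∘ sym))

  *-cancel-pos : ∀ {x y} → 0# < x → 0# < x * y → 0# < y
  *-cancel-pos {x} {y} 0<x 0<xy with compare y 0#
  ... | tri< y<0 _ _ = contradiction
    (+-pos 0<xy (*-pos 0<x (<0⇒0<- y<0)))
    (<-irrefl (solve 2 (λ x y → :0 := x :* y :+ x :* (:- y)) refl x y))
  ... | tri≈ _ y≈0 _ = contradiction 0<xy (<-irrefl (sym (trans (*-congˡ y≈0) (zeroʳ x))))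
  ... | tri> _ _ 0<y = 0<y

  *-cancelˡ-0 : ∀ {x y} → ¬ (x ≈ 0#) → x * y ≈ 0# → y ≈ 0#
  *-cancelˡ-0 {x} {y} x≉0 xy≈0 with inverse x x≉0
  ... | w , xw≈1 = trans (sym (*-identityˡ y)) (trans (*-congʳ (sym xw≈1))
    (trans (solve 3 (λ x w y → x :* w :* y := w :* (x :* y)) refl x w y)
      (trans (*-congˡ xy≈0) (zeroʳ w))))

  infix 4 0≤_
  -- The disjunction allows case analysis: a sum of such terms is positive as soon as one of them
  -- is.
  0≤_ : Carrier → Set ℓ
  0≤ x = x ≈ 0# ⊎ 0# < x

  square-0≤ : ∀ x → 0≤ x * x
  square-0≤ x with compare x 0#
  ... | tri< _ x≉0 _ = inj₂ (square-pos x≉0)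
  ... | tri≈ _ x≈0 _ = inj₁ (trans (*-congʳ x≈0) (zeroˡ x))
  ... | tri> _ x≉0 _ = inj₂ (square-pos x≉0)

  +-0≤-pos : ∀ {x y} → 0≤ x → 0# < y → 0# < x + y
  +-0≤-pos (inj₁ x≈0) 0<y = <-respʳ (sym (trans (+-congʳ x≈0) (+-identityˡ _))) 0<y
  +-0≤-pos (inj₂ 0<x) 0<y = +-pos 0<x 0<y

  +-0≤ : ∀ {x y} → 0≤ x → 0≤ y → 0≤ x + y
  +-0≤ 0≤x (inj₂ 0<y)        = inj₂ (+-0≤-pos 0≤x 0<y)
  +-0≤ (inj₁ x≈0) (inj₁ y≈0) = inj₁ (trans (+-cong x≈0 y≈0) (+-identityˡ 0#))
  +-0≤ (inj₂ 0<x) (inj₁ y≈0) = inj₂ (<-respʳ (sym (trans (+-congˡ y≈0) (+-identityʳ _))) 0<x)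

  ∑-0≤ : ∀ {n} {f : Vector Carrier n} → (∀ i → 0≤ f i) → 0≤ ∑ f
  ∑-0≤ {zero}  0≤f = inj₁ (∑-empty _)
  ∑-0≤ {suc n} 0≤f with +-0≤ (0≤f zero) (∑-0≤ (0≤f ∘ suc))
  ... | inj₁ eq = inj₁ (trans (∑-suc _) eq)
  ... | inj₂ lt = inj₂ (<-respʳ (sym (∑-suc _)) lt)

  ∑-pos : ∀ {n} {f : Vector Carrier n} → (∀ i → 0≤ f i) → ∀ i → 0# < f i → 0# < ∑ f
  ∑-pos {suc n} {f} 0≤f i 0<fi = <-respʳ (sym (trans (∑-remove i f) (+-comm _ _)))
    (+-0≤-pos (∑-0≤ (0≤f ∘ punchIn i)) 0<fi)

  nat : ℕ → Carrier
  nat zero    = 0#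
  nat (suc n) = 1# + nat n

  nat-pos : ∀ n → 0# < nat (suc n)
  nat-pos zero    = <-respʳ (sym (+-identityʳ 1#)) 0<1
  nat-pos (suc n) = +-pos 0<1 (nat-pos n)

  ∑-const : ∀ n x → ∑ {n} (λ _ → x) ≈ nat n * x
  ∑-const zero    x = trans (∑-empty _) (sym (zeroˡ x))
  ∑-const (suc n) x = trans (∑-suc _) (trans (+-congˡ (∑-const n x))
    (solve 2 (λ n x → x :+ n :* x := (:1 :+ n) :* x) refl (nat n) x))

  -- The result is an index and not a value, so that the entry can be split off by `punchIn` and
  -- `∏-remove`.
  minimum : ∀ {n} (f : Vector Carrier (suc n)) → ∃ λ k → ∀ i → ¬ (f i < f k)
  minimum {zero}  f = zero , λ { zero → <-irrefl refl }
  minimum {suc n} f with minimum (f ∘ suc)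
  ... | k , min with compare (f zero) (f (suc k))
  ...   | tri< f0<fk _ _ = zero , λ where
            zero    → <-irrefl refl
            (suc i) fi<f0 → min i (<-trans fi<f0 f0<fk)
  ...   | tri≈ f0≮fk _ _ = suc k , λ { zero → f0≮fk ; (suc i) → min i }
  ...   | tri> f0≮fk _ _ = suc k , λ { zero → f0≮fk ; (suc i) → min i }

-- Realizing every positive spectrum on the complete graph.

module Laplacians {a ℓ} (ℝ : CompleteOrderedField a ℓ) where

  open CompleteOrderedField ℝ hiding (zero)
  open Determinants ℝ
  open Order ℝ
  open RingProperties ring
  open IntegerSolver commutativeRing
  open import Relation.Binary.Reasoning.Setoid setoid

  δ : ∀ {n} → Matrix ℝ n
  δ = identity ℝ

  ∑-δ : ∀ {n} (i : Fin n) (f : Vector Carrier n) → ∑ (λ j → δ i j * f j) ≈ f i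
  ∑-δ zero    f = trans (∑-suc _) (trans (+-cong (*-identityˡ _) (∑-zero λ _ → zeroˡ _)) (+-identityʳ _))
  ∑-δ (suc i) f = trans (∑-suc _) (trans (+-cong (zeroˡ _) (∑-δ i (f ∘ suc))) (+-identityˡ _))

  -- The last sum has the shape of the `diagonal` condition on Laplacians, which this turns into
  -- vanishing row sums.
  ∑-split : ∀ {n} (i : Fin n) (f : Vector Carrier n) → ∑ f ≈ f i + ∑ (λ k → if does (k ≟ i) then 0# else f k)
  ∑-split zero f = trans (∑-suc f) (+-congˡ (sym (trans (∑-suc _) (+-identityˡ _))))
  ∑-split (suc i) f = begin
    ∑ f                                  ≈⟨ ∑-suc f ⟩
    f zero + ∑ (f ∘ suc)                 ≈⟨ +-congˡ (∑-split i (f ∘ suc)) ⟩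
    f zero + (f (suc i) + ∑ g)           ≈⟨ solve 3 (λ x y z → x :+ (y :+ z) := y :+ (x :+ z)) refl _ _ _ ⟩
    f (suc i) + (f zero + ∑ g)           ≈⟨ +-congˡ (∑-suc _) ⟨
    f (suc i) + ∑ (λ k → if does (k ≟ suc i) then 0# else f k) ∎
    where g = λ k → if does (k ≟ i) then 0# else f (suc k)

  ∑-neg : ∀ {n} (f : Vector Carrier n) → ∑ (λ i → - 1# * f i) ≈ - ∑ f
  ∑-neg f = trans (sym (*-distribˡ-∑ (- 1#) f)) (-1*x≈-x _)

  RowSumsZero : ∀ {n} → Matrix ℝ n → Set ℓ
  RowSumsZero A = ∀ i → ∑ (A i) ≈ 0#

  -- The matrix xI - A, whose determinant is the characteristic polynomial.
  x-_ : ∀ {n} → Carrier → Matrix ℝ n → Matrix ℝ n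
  (x- x) A i j = x * δ i j - A i j

  ∑-x- : ∀ {n} {A : Matrix ℝ n} → RowSumsZero A → ∀ x i → ∑ ((x- x) A i) ≈ x
  ∑-x- {A = A} rows x i = begin
    ∑ (λ j → x * δ i j - A i j)
      ≈⟨ ∑-cong (λ j → solve 3 (λ x d a → x :* d :- a := d :* x :+ :- :1 :* a) refl x (δ i j) (A i j)) ⟩
    ∑ (λ j → δ i j * x + - 1# * A i j)
      ≈⟨ ∑-distrib-+ (λ j → δ i j * x) (λ j → - 1# * A i j) ⟩
    ∑ (λ j → δ i j * x) + ∑ (λ j → - 1# * A i j)
      ≈⟨ +-cong (∑-δ i (λ _ → x)) (trans (∑-neg (A i)) (trans (-‿cong (rows i)) -0#≈0#)) ⟩
    x + 0#
      ≈⟨ +-identityʳ x ⟩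
    x ∎

  -- The columns of xI - A add up to `x` times the column of ones, so the first column is that
  -- multiple minus all other columns.
  firstColumn : ∀ {n} {A : Matrix ℝ (suc n)} → RowSumsZero A → ∀ x i →
                (x- x) A i zero ≈ x * 1# + ∑ (λ k → - 1# * (x- x) A i (suc k))
  firstColumn {A = A} rows x i = begin
    m                ≈⟨ solve 2 (λ m s → m := (m :+ s) :* :1 :- s) refl m s ⟩
    (m + s) * 1# - s ≈⟨ +-cong (*-congʳ (trans (sym (∑-suc _)) (∑-x- rows x i))) (sym (∑-neg _)) ⟩
    x * 1# + ∑ (λ k → - 1# * (x- x) A i (suc k)) ∎
    where
    m = (x- x) A i zero
    s = ∑ (λ k → (x- x) A i (suc k))

  reduced : ∀ {n} → Matrix ℝ (suc n) → Carrier → Carrier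
  reduced A x = Det ((λ _ → 1#) ∣ λ i j → (x- x) A i (suc j))

  -- By `firstColumn`, adding the other columns to the first turns it into `x` times the column of
  -- ones, and `x` factors out.
  charPoly-reduced : ∀ {n} {A : Matrix ℝ (suc n)} → RowSumsZero A → ∀ x →
                     charPoly ℝ A x ≈ x * reduced A x
  charPoly-reduced {A = A} rows x = begin
    charPoly ℝ A x
      ≡⟨ det≡Det _ ⟩
    Det ((x- x) A)
      ≈⟨ Det-cong (λ { i zero → firstColumn rows x i ; i (suc j) → refl }) ⟩
    Det ((λ i → x * 1# + ∑ (λ k → - 1# * W i k)) ∣ W)
      ≈⟨ Det-colAdd (λ _ → x * 1#) (λ _ → - 1#) W ⟩
    Det ((λ _ → x * 1#) ∣ W)
      ≈⟨ Det-scale∣ x (λ _ → 1#) W ⟩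
    x * reduced A x ∎
    where W = λ i j → (x- x) A i (suc j)

  -- The corner and the shift by `b` on the old diagonal keep the row sums at 0. The column (n, -1,
  -- ..., -1) is then an eigenvector for (n + 1)b when the rows of `A` sum to 0.
  border : ∀ {n} → Carrier → Matrix ℝ n → Matrix ℝ (suc n)
  border {n} b A zero    zero    = nat n * b
  border     b A zero    (suc j) = - b
  border     b A (suc i) zero    = - b
  border     b A (suc i) (suc j) = A i j + δ i j * b

  border-rows : ∀ {n} {A : Matrix ℝ n} b → RowSumsZero A → RowSumsZero (border b A)
  border-rows {n} b rows zero = begin
    ∑ (border b _ zero)      ≈⟨ ∑-suc _ ⟩
    nat n * b + ∑ {n} (λ _ → - b)  ≈⟨ +-congˡ (∑-const n (- b)) ⟩
    nat n * b + nat n * - b  ≈⟨ solve 2 (λ n b → n :* b :+ n :* (:- b) := :0) refl (nat n) b ⟩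
    0#                       ∎
  border-rows {A = A} b rows (suc i) = begin
    ∑ (border b A (suc i))                   ≈⟨ ∑-suc _ ⟩
    - b + ∑ (λ j → A i j + δ i j * b)        ≈⟨ +-congˡ (∑-distrib-+ (A i) (λ j → δ i j * b)) ⟩
    - b + (∑ (A i) + ∑ (λ j → δ i j * b))    ≈⟨ +-congˡ (+-cong (rows i) (∑-δ i (λ _ → b))) ⟩
    - b + (0# + b)                           ≈⟨ solve 1 (λ b → :- b :+ (:0 :+ b) := :0) refl b ⟩
    0#                                       ∎

  -- With `y = x - b`, the block below the border is yI - A. Column operations clear the first
  -- column of that block, leaving a single entry at the top, whose minor is the reduced determinant
  -- of `A` at `y`.
  border-reduced : ∀ {n} {A : Matrix ℝ (suc n)} b → RowSumsZero A → ∀ x →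
                   reduced (border b A) x ≈ (x - nat (suc (suc n)) * b) * reduced A (x - b)
  border-reduced {n} {A} b rows x = begin
    Det (1ᵛ ∣ N)
      -- The minus sign is `sgn (suc zero)`, the cost of moving the second column in front of the
      -- column of ones.
      ≈⟨ solve 1 (λ d → d := :- (:- :1 :* :1 :* d)) refl _ ⟩
    - (sgn (suc (zero {n})) * Det (1ᵛ ∣ N))
      ≈⟨ -‿cong (Det-front (suc zero) (1ᵛ ∣ N)) ⟨
    - Det ((λ i → N i zero) ∣ W)
      ≈⟨ -‿cong (Det-∣-cong column (λ _ _ → refl)) ⟩
    - Det ((λ i → u i + ∑ (λ k → w k * W i k)) ∣ W)
      ≈⟨ -‿cong (Det-colAdd u w W) ⟩
    - Det (u ∣ W)
      ≈⟨ -‿cong (Det-expand u W) ⟩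
    - (u zero * Det (W ∘ suc) + ∑ (λ j → - 1# * sgn j * W zero j * Det ((λ _ → 0#) ∣ delete j (W ∘ suc))))
      ≈⟨ -‿cong (+-cong (*-congˡ lower) (∑-zero λ j → trans (*-congˡ (Det-0∣ _)) (zeroʳ _))) ⟩
    - (u zero * reduced A y + 0#)
      ≈⟨ solve 4 (λ n x b r → :- (((:1 :+ n) :* b :- (x :- b)) :* r :+ :0) := (x :- (:1 :+ (:1 :+ n)) :* b) :* r)
           refl (nat n) x b (reduced A y) ⟩
    (x - nat (suc (suc n)) * b) * reduced A y ∎
    where
    y = x - b
    1ᵛ = λ _ → 1#
    N = λ i j → (x- x) (border b A) i (suc j)
    W = delete (suc zero) (1ᵛ ∣ N)

    -- What is left of the moved column after the other columns have been used to clear it below the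
    -- top.
    u : Vector Carrier (suc (suc n))
    u zero    = nat (suc n) * b - y
    u (suc _) = 0#

    -- The coefficients of `firstColumn` for `A` at `y`: `y` for the column of ones and -1 for each
    -- further column.
    w : Vector Carrier (suc n)
    w zero    = y
    w (suc _) = - 1#

    N-suc : ∀ i j → N (suc i) j ≈ (x- y) A i j
    N-suc i j = solve 4 (λ x d a b → x :* d :- (a :+ d :* b) := (x :- b) :* d :- a) refl x (δ i j) (A i j) b

    N-zero : ∀ j → N zero j ≈ b
    N-zero j = solve 2 (λ x b → x :* :0 :- (:- b) := b) refl x b

    lower : Det (W ∘ suc) ≈ reduced A y
    lower = Det-cong λ { i zero → refl ; i (suc j) → N-suc i (suc j) }

    column : ∀ i → N i zero ≈ u i + ∑ (λ k → w k * W i k)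
    column zero = begin
      N zero zero
        ≈⟨ N-zero zero ⟩
      b
        ≈⟨ solve 3 (λ n b y → b := ((:1 :+ n) :* b :- y) :+ (y :* :1 :+ n :* (:- :1 :* b)))
             refl (nat n) b y ⟩
      u zero + (y * 1# + nat n * (- 1# * b))
        ≈⟨ +-congˡ (+-congˡ (∑-const n (- 1# * b))) ⟨
      u zero + (y * 1# + ∑ {n} (λ _ → - 1# * b))
        ≈⟨ +-congˡ (trans (∑-suc _) (+-congˡ (∑-cong λ k → *-congˡ (N-zero (suc k))))) ⟨
      u zero + ∑ (λ k → w k * W zero k) ∎
    column (suc i) = begin
      N (suc i) zero
        ≈⟨ N-suc i zero ⟩
      (x- y) A i zero
        ≈⟨ firstColumn rows y i ⟩
      y * 1# + ∑ (λ k → - 1# * (x- y) A i (suc k))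
        ≈⟨ trans (∑-suc _) (+-congˡ (∑-cong λ k → *-congˡ (N-suc i (suc k)))) ⟨
      ∑ (λ k → w k * W (suc i) k)
        ≈⟨ +-identityˡ _ ⟨
      0# + ∑ (λ k → w k * W (suc i) k) ∎

  -- The invariant of the induction. The eigenvalue 0 is not among the `λs`: it is carried by
  -- `rows`, and `spectrum` describes the characteristic polynomial divided by `x`.
  record CompleteLaplacian {n} (λs : Vector Carrier n) : Set (a ⊔ ℓ) where
    field
      matrix    : Matrix ℝ (suc n)
      symmetric : ∀ i j → matrix i j ≈ matrix j i
      negative  : ∀ i j → i ≢ j → matrix i j < 0#
      rows      : RowSumsZero matrix
      spectrum  : ∀ x → reduced matrix x ≈ ∏ (λ i → x - λs i)

  δ-sym : ∀ {n} (i j : Fin n) → δ i j ≈ δ j i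
  δ-sym zero    zero    = refl
  δ-sym zero    (suc j) = refl
  δ-sym (suc i) zero    = refl
  δ-sym (suc i) (suc j) = δ-sym i j

  δ-≢ : ∀ {n} {i j : Fin n} → i ≢ j → δ i j ≈ 0#
  δ-≢ {i = i} {j} i≢j with i ≟ j
  ... | yes i≡j = contradiction i≡j i≢j
  ... | no  _   = refl

  completeLaplacian : ∀ {n} (λs : Vector Carrier n) → (∀ i → 0# < λs i) → CompleteLaplacian λs
  completeLaplacian {zero} λs pos = record
    { matrix    = λ _ _ → 0#
    ; symmetric = λ _ _ → refl
    ; negative  = λ { zero zero 0≢0 → contradiction ≡.refl 0≢0 }
    ; rows      = λ _ → ∑-zero λ _ → refl
    ; spectrum  = λ x → trans (Det-1×1 _) (sym (∏-empty _))
    }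
  completeLaplacian {suc n} λs pos = record
    { matrix    = border b A.matrix
    ; symmetric = λ where
        zero    zero    → refl
        zero    (suc j) → refl
        (suc i) zero    → refl
        (suc i) (suc j) → +-cong (A.symmetric i j) (*-congʳ (δ-sym i j))
    ; negative  = λ where
        zero    zero    0≢0 → contradiction ≡.refl 0≢0
        zero    (suc j) _   → 0<⇒-<0 0<b
        (suc i) zero    _   → 0<⇒-<0 0<b
        (suc i) (suc j) i≢j → <-respˡ
          (sym (trans (+-congˡ (trans (*-congʳ (δ-≢ (i≢j ∘ ≡.cong suc))) (zeroˡ b))) (+-identityʳ _)))
          (A.negative i j (i≢j ∘ ≡.cong suc))
    ; rows      = border-rows b A.rows
    ; spectrum  = spectrum
    }
    where
    N = nat (suc (suc n))
    k = proj₁ (minimum λs)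
    w = proj₁ (inverse N λ N≈0 → <-irrefl (sym N≈0) (nat-pos (suc n)))
    -- `N` is the size of the bordered matrix, so the eigenvalue `N * b` created by the border is
    -- the smallest prescribed number.
    b = λs k * w

    Nb≈λₖ : N * b ≈ λs k
    Nb≈λₖ = begin
      N * (λs k * w) ≈⟨ solve 3 (λ N l w → N :* (l :* w) := (N :* w) :* l) refl N (λs k) w ⟩
      N * w * λs k   ≈⟨ *-congʳ (proj₂ (inverse N _)) ⟩
      1# * λs k      ≈⟨ *-identityˡ _ ⟩
      λs k           ∎

    0<b : 0# < b
    0<b = *-cancel-pos (nat-pos (suc n)) (<-respʳ (sym Nb≈λₖ) (pos k))

    -- The difference `λs k - b` is `nat (suc n) * b`.
    b<λₖ : b < λs k
    b<λₖ = 0<-⇒< (<-respʳ (trans (solve 2 (λ n b → n :* b := (:1 :+ n) :* b :- b) refl (nat (suc n)) b) (+-congʳ Nb≈λₖ))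
                    (*-pos (nat-pos n) 0<b))

    μs : Vector Carrier n
    μs i = λs (punchIn k i) - b

    -- Since `λs k` is minimal, no remaining number lies below it, and `λs k` itself exceeds `b`.
    μs-pos : ∀ i → 0# < μs i
    μs-pos i with compare (λs (punchIn k i)) (λs k)
    ... | tri< l _ _ = contradiction l (proj₂ (minimum λs) (punchIn k i))
    ... | tri≈ _ e _ = <⇒0<- (<-respʳ (sym e) b<λₖ)
    ... | tri> _ _ g = <⇒0<- (<-trans b<λₖ g)

    module A = CompleteLaplacian (completeLaplacian μs μs-pos)

    spectrum : ∀ x → reduced (border b A.matrix) x ≈ ∏ (λ i → x - λs i)
    spectrum x = begin
      reduced (border b A.matrix) x
        ≈⟨ border-reduced b A.rows x ⟩
      (x - N * b) * reduced A.matrix (x - b)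
        ≈⟨ *-cong (+-congˡ (-‿cong Nb≈λₖ)) (A.spectrum (x - b)) ⟩
      (x - λs k) * ∏ (λ i → x - b - μs i)
        ≈⟨ *-congˡ (∏-cong λ i → solve 3 (λ x b l → x :- b :- (l :- b) := x :- l)
             refl x b (λs (punchIn k i))) ⟩
      (x - λs k) * ∏ (λ i → x - λs (punchIn k i))
        ≈⟨ ∏-remove k (λ i → x - λs i) ⟨
      ∏ (λ i → x - λs i) ∎

  foldr-lookup : ∀ {n} x (λs : Vec Carrier n) →
                 List.foldr _*_ 1# (List.map (λ μ → x - μ) (Vec.toList λs)) ≈ ∏ (λ i → x - Vec.lookup λs i)
  foldr-lookup x []       = sym (∏-empty _)
  foldr-lookup x (μ ∷ λs) = sym (trans (∏-suc _) (*-congˡ (sym (foldr-lookup x λs))))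

  complete-realizable : ∀ n → EveryPositiveRealizable ℝ (K (suc n))
  complete-realizable n λs pos = A.matrix , laplacian , spectrum
    where
    module A = CompleteLaplacian (completeLaplacian (Vec.lookup λs) (λ i → All.lookup⁺ pos i))

    laplacian : GeneralizedLaplacian ℝ (K (suc n)) A.matrix
    laplacian = record
      { symmetric = A.symmetric
      ; edge      = A.negative
      ; non-edge  = λ i j i≢j ¬i≢j → contradiction i≢j ¬i≢j
      -- The vanishing row sum, solved for the diagonal entry.
      ; diagonal  = λ i → +-inverseˡ-unique _ _ (trans (+-congˡ (reflexive (sum≡∑ _)))
                            (trans (sym (∑-split i (A.matrix i))) (A.rows i)))
      }

    spectrum : HasSpectrum ℝ A.matrix (0# ∷ Vec.toList λs)
    spectrum x = begin
      charPoly ℝ A.matrix x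
        ≈⟨ charPoly-reduced A.rows x ⟩
      x * reduced A.matrix x
        ≈⟨ *-cong (solve 1 (λ x → x := x :- :0) refl x) (A.spectrum x) ⟩
      (x - 0#) * ∏ (λ i → x - Vec.lookup λs i)
        ≈⟨ *-congˡ (foldr-lookup x λs) ⟨
      (x - 0#) * List.foldr _*_ 1# (List.map (λ μ → x - μ) (Vec.toList λs)) ∎

-- Polynomial functions and comparison of coefficients.

module Polynomials {a ℓ} (ℝ : CompleteOrderedField a ℓ) where

  open CompleteOrderedField ℝ hiding (zero)
  open Determinants ℝ
  open Order ℝ
  open RingProperties ring
  open IntegerSolver commutativeRing
  open import Relation.Binary.Reasoning.Setoid setoid

  eval : List Carrier → Carrier → Carrier
  eval []      t = 0#
  eval (x ∷ p) t = x + t * eval p t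

  -- The coefficients are listed from the constant term upwards and may end in zeros, so the length
  -- of the list bounds the degree without determining it.
  record IsPoly (f : Carrier → Carrier) : Set (a ⊔ ℓ) where
    constructor poly
    field
      coeffs     : List Carrier
      evaluation : ∀ t → f t ≈ eval coeffs t

  IsPoly-cong : ∀ {f g} → (∀ t → f t ≈ g t) → IsPoly f → IsPoly g
  IsPoly-cong f≈g (poly p f≈p) = poly p λ t → trans (sym (f≈g t)) (f≈p t)

  IsPoly-const : ∀ x → IsPoly (λ _ → x)
  IsPoly-const x = poly (x ∷ []) λ t → solve 2 (λ x t → x := x :+ t :* :0) refl x t

  IsPoly-id : IsPoly (λ t → t)
  IsPoly-id = poly (0# ∷ 1# ∷ []) λ t → solve 1 (λ t → t := :0 :+ t :* (:1 :+ t :* :0)) refl t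

  private
    add : List Carrier → List Carrier → List Carrier
    add []      q       = q
    add (x ∷ p) []      = x ∷ p
    add (x ∷ p) (y ∷ q) = x + y ∷ add p q

    eval-add : ∀ p q t → eval (add p q) t ≈ eval p t + eval q t
    eval-add []      q       t = sym (+-identityˡ _)
    eval-add (x ∷ p) []      t = sym (+-identityʳ _)
    eval-add (x ∷ p) (y ∷ q) t = trans (+-congˡ (*-congˡ (eval-add p q t)))
      (solve 5 (λ x y t p q → x :+ y :+ t :* (p :+ q) := (x :+ t :* p) :+ (y :+ t :* q)) refl x y t _ _)

    scale : Carrier → List Carrier → List Carrier
    scale x = List.map (x *_)

    eval-scale : ∀ x p t → eval (scale x p) t ≈ x * eval p t
    eval-scale x []      t = sym (zeroʳ x)
    eval-scale x (y ∷ p) t = trans (+-congˡ (*-congˡ (eval-scale x p t)))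
      (solve 4 (λ x y t p → x :* y :+ t :* (x :* p) := x :* (y :+ t :* p)) refl x y t _)

    mul : List Carrier → List Carrier → List Carrier
    mul []      q = []
    mul (x ∷ p) q = add (scale x q) (0# ∷ mul p q)

    eval-mul : ∀ p q t → eval (mul p q) t ≈ eval p t * eval q t
    eval-mul []      q t = sym (zeroˡ _)
    eval-mul (x ∷ p) q t = begin
      eval (add (scale x q) (0# ∷ mul p q)) t        ≈⟨ eval-add (scale x q) (0# ∷ mul p q) t ⟩
      eval (scale x q) t + (0# + t * eval (mul p q) t)
        ≈⟨ +-cong (eval-scale x q t) (+-congˡ (*-congˡ (eval-mul p q t))) ⟩
      x * eval q t + (0# + t * (eval p t * eval q t))
        ≈⟨ solve 4 (λ x t p q → x :* q :+ (:0 :+ t :* (p :* q)) := (x :+ t :* p) :* q) refl x t _ _ ⟩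
      (x + t * eval p t) * eval q t                  ∎

  IsPoly-+ : ∀ {f g} → IsPoly f → IsPoly g → IsPoly (λ t → f t + g t)
  IsPoly-+ (poly p f≈p) (poly q g≈q) = poly (add p q) λ t →
    trans (+-cong (f≈p t) (g≈q t)) (sym (eval-add p q t))

  IsPoly-* : ∀ {f g} → IsPoly f → IsPoly g → IsPoly (λ t → f t * g t)
  IsPoly-* (poly p f≈p) (poly q g≈q) = poly (mul p q) λ t →
    trans (*-cong (f≈p t) (g≈q t)) (sym (eval-mul p q t))

  IsPoly-neg : ∀ {f} → IsPoly f → IsPoly (λ t → - f t)
  IsPoly-neg f-poly = IsPoly-cong (λ t → -1*x≈-x _) (IsPoly-* (IsPoly-const (- 1#)) f-poly)

  IsPoly-∑ : ∀ {n} {f : Fin n → Carrier → Carrier} → (∀ i → IsPoly (f i)) → IsPoly (λ t → ∑ (λ i → f i t))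
  IsPoly-∑ {zero}  f-poly = IsPoly-cong (λ t → sym (∑-empty _)) (IsPoly-const 0#)
  IsPoly-∑ {suc n} f-poly = IsPoly-cong (λ t → sym (∑-suc _)) (IsPoly-+ (f-poly zero) (IsPoly-∑ (f-poly ∘ suc)))

  IsPoly-Det : ∀ {n} {M : Carrier → Matrix ℝ n} → (∀ i j → IsPoly (λ t → M t i j)) → IsPoly (λ t → Det (M t))
  IsPoly-Det {zero}  M-poly = IsPoly-cong (λ t → sym (Det-empty _)) (IsPoly-const 1#)
  IsPoly-Det {suc n} M-poly = IsPoly-cong (λ t → sym (Det-suc _)) (IsPoly-∑ λ j →
    IsPoly-* (IsPoly-* (IsPoly-const (sgn j)) (M-poly zero j)) (IsPoly-Det λ i k → M-poly (suc i) (punchIn j k)))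

  -- Dropping the constant coefficient gives the quotient of f(t) - f(0) by t without any division.
  IsPoly-split : ∀ {f} → IsPoly f → ∃ λ h → IsPoly h × (∀ t → f t ≈ f 0# + t * h t)
  IsPoly-split {f} (poly [] f≈p) = (λ _ → 0#) , IsPoly-const 0# , λ t →
    trans (f≈p t) (trans (sym (f≈p 0#)) (solve 2 (λ x t → x := x :+ t :* :0) refl (f 0#) t))
  IsPoly-split {f} (poly (x ∷ p) f≈p) = eval p , poly p (λ _ → refl) , λ t →
    trans (f≈p t) (+-congʳ (sym (trans (f≈p 0#) (solve 2 (λ x y → x :+ :0 :* y := x) refl x _))))

  AllZero : List Carrier → Set (a ⊔ ℓ)
  AllZero = ListAll.All (_≈ 0#)

  eval-AllZero : ∀ {p} → AllZero p → ∀ t → eval p t ≈ 0#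
  eval-AllZero []          t = refl
  eval-AllZero (x≈0 ∷ p≈0) t = trans (+-cong x≈0 (*-congˡ (eval-AllZero p≈0 t)))
    (solve 1 (λ t → :0 :+ t :* :0 := :0) refl t)

  2≉0 : ¬ (1# + 1# ≈ 0#)
  2≉0 2≈0 = <-irrefl (sym 2≈0) (+-pos 0<1 0<1)

  private
    -- The coefficients of s p(2t) - p(t).
    dilate : Carrier → List Carrier → List Carrier
    dilate s []      = []
    dilate s (x ∷ p) = (s - 1#) * x ∷ dilate (s + s) p

    eval-dilate : ∀ s p t → eval (dilate s p) t ≈ s * eval p (t + t) - eval p t
    eval-dilate s []      t = solve 1 (λ s → :0 := s :* :0 :- :0) refl s
    eval-dilate s (x ∷ p) t = trans (+-congˡ (*-congˡ (eval-dilate (s + s) p t)))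
      (solve 5 (λ s x t p q → (s :- :1) :* x :+ t :* ((s :+ s) :* p :- q) := s :* (x :+ (t :+ t) :* p) :- (x :+ t :* q))
        refl s x t (eval p (t + t)) (eval p t))

    length-dilate : ∀ s p → List.length (dilate s p) ≡ List.length p
    length-dilate s []      = ≡.refl
    length-dilate s (x ∷ p) = ≡.cong suc (length-dilate (s + s) p)

    -- The coefficients of `p` are multiplied by s - 1, 2s - 1, 4s - 1 and so on, all of them
    -- positive when `1# < s`.
    dilate-AllZero : ∀ {s} p → 1# < s → AllZero (dilate s p) → AllZero p
    dilate-AllZero     []      1<s []          = []
    dilate-AllZero {s} (x ∷ p) 1<s (x≈0 ∷ p≈0) =
      *-cancelˡ-0 (λ s-1≈0 → <-irrefl (sym s-1≈0) (<⇒0<- 1<s)) x≈0 ∷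
      dilate-AllZero p (<-trans 1<s (<-respˡ (+-identityˡ s) (+-monoˡ-< s (<-trans 0<1 1<s)))) p≈0

  -- Write the polynomial as x + t p(t). Subtracting its values at 2t and t eliminates `x` and shows
  -- that 2p(2t) - p(t) vanishes off 0. This has as many coefficients as `p`, so induction on the
  -- length makes `p` zero, and then `x` is the value at 1. The point 0 is excluded because `t` will
  -- be a reciprocal.
  vanishing : ∀ n p → List.length p ≡ n → (∀ t → ¬ (t ≈ 0#) → eval p t ≈ 0#) → AllZero p
  vanishing zero    []      _  _   = []
  vanishing (suc n) (x ∷ p) eq p≈0 = trans x≈ (p≈0 1# (0≉1 ∘ sym)) ∷ tail≈0
    where
    2# = 1# + 1#

    dilated≈0 : ∀ t → ¬ (t ≈ 0#) → eval (dilate 2# p) t ≈ 0#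
    dilated≈0 t t≉0 = *-cancelˡ-0 t≉0 (begin
      t * eval (dilate 2# p) t
        ≈⟨ *-congˡ (eval-dilate 2# p t) ⟩
      t * (2# * eval p (t + t) - eval p t)
        ≈⟨ solve 4 (λ t x p q → t :* ((:1 :+ :1) :* p :- q) := (x :+ (t :+ t) :* p) :- (x :+ t :* q))
             refl t x (eval p (t + t)) (eval p t) ⟩
      eval (x ∷ p) (t + t) - eval (x ∷ p) t
        ≈⟨ +-cong (p≈0 (t + t) t+t≉0) (-‿cong (p≈0 t t≉0)) ⟩
      0# - 0#
        ≈⟨ -‿inverseʳ 0# ⟩
      0# ∎)
      where
      t+t≉0 : ¬ (t + t ≈ 0#)
      t+t≉0 t+t≈0 = t≉0 (*-cancelˡ-0 2≉0 (trans (solve 1 (λ t → (:1 :+ :1) :* t := t :+ t) refl t) t+t≈0))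

    tail≈0 : AllZero p
    tail≈0 = dilate-AllZero p (<-respˡ (+-identityˡ 1#) (+-monoˡ-< 1# 0<1))
      (vanishing n (dilate 2# p) (≡.trans (length-dilate 2# p) (ℕ.suc-injective eq)) dilated≈0)

    x≈ : x ≈ eval (x ∷ p) 1#
    x≈ = trans (solve 1 (λ x → x := x :+ :1 :* :0) refl x) (+-congˡ (*-congˡ (sym (eval-AllZero tail≈0 1#))))

-- Traces read off from the spectrum.

module Traces {a ℓ} (ℝ : CompleteOrderedField a ℓ) where

  open CompleteOrderedField ℝ hiding (zero)
  open Determinants ℝ
  open Order ℝ
  open Laplacians ℝ
  open Polynomials ℝ
  open RingProperties ring
  open IntegerSolver commutativeRing
  open SemiringExp semiring using (_^_)
  open import Relation.Binary.Reasoning.Setoid setoid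

  2# = 1# + 1#

  -- f behaves up to order 2 at 0 like the product of the 1 - tμ over a multiset
  -- of numbers μ with sum s and sum of squares p.
  record Expands (f : Carrier → Carrier) (s p : Carrier) : Set (a ⊔ ℓ) where
    field
      remainder : Carrier → Carrier
      isPoly    : IsPoly remainder
      expansion : ∀ t → 2# * f t ≈ 2# - 2# * s * t + (s * s - p) * (t * t) + t * t * t * remainder t

  Expands-cong : ∀ {f g s s′ p p′} → (∀ t → f t ≈ g t) → s ≈ s′ → p ≈ p′ → Expands f s p →
                 Expands g s′ p′
  Expands-cong f≈g s≈s′ p≈p′ F = record
    { remainder = F.remainder
    ; isPoly    = F.isPoly
    ; expansion = λ t → trans (*-congˡ (sym (f≈g t))) (trans (F.expansion t)
        (+-congʳ (+-cong (+-congˡ (-‿cong (*-congʳ (*-congˡ s≈s′))))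
          (*-congʳ (+-cong (*-cong s≈s′ s≈s′) (-‿cong p≈p′))))))
    }
    where module F = Expands F

  Expands-1 : Expands (λ _ → 1#) 0# 0#
  Expands-1 = record
    { remainder = λ _ → 0#
    ; isPoly    = IsPoly-const 0#
    ; expansion = λ t → solve 1 (λ t → (:1 :+ :1) :* :1 :=
        (:1 :+ :1) :- (:1 :+ :1) :* :0 :* t :+ (:0 :* :0 :- :0) :* (t :* t) :+ t :* t :* t :* :0) refl t
    }

  -- The factor adds the number `x` to the multiset.
  Expands-* : ∀ {f s p} x → Expands f s p → Expands (λ t → (1# - t * x) * f t) (x + s) (x * x + p)
  Expands-* {f} {s} {p} x F = record
    { remainder = λ t → F.remainder t + - (x * (s * s - p) + x * (t * F.remainder t))
    ; isPoly    = IsPoly-+ F.isPoly (IsPoly-neg (IsPoly-+ (IsPoly-const _)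
                    (IsPoly-* (IsPoly-const x) (IsPoly-* IsPoly-id F.isPoly))))
    ; expansion = λ t → begin
        2# * ((1# - t * x) * f t)
          ≈⟨ solve 3 (λ t x f → (:1 :+ :1) :* ((:1 :- t :* x) :* f) := (:1 :- t :* x) :* ((:1 :+ :1) :* f))
               refl t x (f t) ⟩
        (1# - t * x) * (2# * f t)
          ≈⟨ *-congˡ (F.expansion t) ⟩
        (1# - t * x) * (2# - 2# * s * t + (s * s - p) * (t * t) + t * t * t * F.remainder t)
          ≈⟨ solve 5 (λ t x s p h →
               (:1 :- t :* x) :* ((:1 :+ :1) :- (:1 :+ :1) :* s :* t :+ (s :* s :- p) :* (t :* t) :+ t :* t :* t :* h) :=
               (:1 :+ :1) :- (:1 :+ :1) :* (x :+ s) :* t :+ ((x :+ s) :* (x :+ s) :- (x :* x :+ p)) :* (t :* t) :+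
                 t :* t :* t :* (h :+ :- (x :* (s :* s :- p) :+ x :* (t :* h)))) refl t x s p (F.remainder t) ⟩
        2# - 2# * (x + s) * t + ((x + s) * (x + s) - (x * x + p)) * (t * t) +
          t * t * t * (F.remainder t + - (x * (s * s - p) + x * (t * F.remainder t))) ∎
    }
    where module F = Expands F

  -- The doubled quadratic coefficient `s * s - p` drops by `2# * w` while `s` stays, so `p` must
  -- grow by `2# * w`.
  Expands-- : ∀ {f g s p} w → Expands f s p → IsPoly g →
              Expands (λ t → f t - t * t * (w + t * g t)) s (p + 2# * w)
  Expands-- {f} {g} {s} {p} w F g-poly = record
    { remainder = λ t → F.remainder t + - (2# * g t)
    ; isPoly    = IsPoly-+ F.isPoly (IsPoly-neg (IsPoly-* (IsPoly-const 2#) g-poly))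
    ; expansion = λ t → begin
        2# * (f t - t * t * (w + t * g t))
          ≈⟨ solve 4 (λ t f w g → (:1 :+ :1) :* (f :- t :* t :* (w :+ t :* g)) :=
               (:1 :+ :1) :* f :- (:1 :+ :1) :* (t :* t :* (w :+ t :* g))) refl t (f t) w (g t) ⟩
        2# * f t - 2# * (t * t * (w + t * g t))
          ≈⟨ +-congʳ (F.expansion t) ⟩
        2# - 2# * s * t + (s * s - p) * (t * t) + t * t * t * F.remainder t - 2# * (t * t * (w + t * g t))
          ≈⟨ solve 6 (λ t s p h w g →
               (:1 :+ :1) :- (:1 :+ :1) :* s :* t :+ (s :* s :- p) :* (t :* t) :+ t :* t :* t :* h
                 :- (:1 :+ :1) :* (t :* t :* (w :+ t :* g)) :=
               (:1 :+ :1) :- (:1 :+ :1) :* s :* t :+ (s :* s :- (p :+ (:1 :+ :1) :* w)) :* (t :* t)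
                 :+ t :* t :* t :* (h :+ :- ((:1 :+ :1) :* g))) refl t s p (F.remainder t) w (g t) ⟩
        2# - 2# * s * t + (s * s - (p + 2# * w)) * (t * t) + t * t * t * (F.remainder t + - (2# * g t)) ∎
    }
    where module F = Expands F

  -- Twice the difference of `f` and `g` is the polynomial with the list `coefficients`. It vanishes
  -- off 0, hence all its coefficients are 0.
  Expands-unique : ∀ {f g s s′ p p′} → (∀ t → ¬ (t ≈ 0#) → f t ≈ g t) →
                   Expands f s p → Expands g s′ p′ → s ≈ s′ × p ≈ p′
  Expands-unique {f} {g} {s} {s′} {p} {p′} f≈g F G = conclude (vanishing _ coefficients ≡.refl vanishes)
    where
    module F = Expands F
    module G = Expands G

    difference : IsPoly (λ t → F.remainder t + - G.remainder t)
    difference = IsPoly-+ F.isPoly (IsPoly-neg G.isPoly)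

    open IsPoly difference

    coefficients : List Carrier
    coefficients = 0# ∷ 2# * (s′ - s) ∷ (s * s - p) - (s′ * s′ - p′) ∷ coeffs

    vanishes : ∀ t → ¬ (t ≈ 0#) → eval coefficients t ≈ 0#
    vanishes t t≉0 = begin
      eval coefficients t
        ≈⟨ +-congˡ (*-congˡ (+-congˡ (*-congˡ (+-congˡ (*-congˡ (evaluation t)))))) ⟨
      0# + t * (2# * (s′ - s) + t * ((s * s - p) - (s′ * s′ - p′) + t * (F.remainder t + - G.remainder t)))
        ≈⟨ solve 7 (λ t s s′ p p′ h k →
             :0 :+ t :* ((:1 :+ :1) :* (s′ :- s) :+ t :* ((s :* s :- p) :- (s′ :* s′ :- p′) :+ t :* (h :+ :- k))) :=
             ((:1 :+ :1) :- (:1 :+ :1) :* s :* t :+ (s :* s :- p) :* (t :* t) :+ t :* t :* t :* h) :-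
             ((:1 :+ :1) :- (:1 :+ :1) :* s′ :* t :+ (s′ :* s′ :- p′) :* (t :* t) :+ t :* t :* t :* k))
             refl t s s′ p p′ (F.remainder t) (G.remainder t) ⟩
      (2# - 2# * s * t + (s * s - p) * (t * t) + t * t * t * F.remainder t) -
      (2# - 2# * s′ * t + (s′ * s′ - p′) * (t * t) + t * t * t * G.remainder t)
        ≈⟨ +-cong (F.expansion t) (-‿cong (G.expansion t)) ⟨
      2# * f t - 2# * g t
        ≈⟨ +-congʳ (*-congˡ (f≈g t t≉0)) ⟩
      2# * g t - 2# * g t
        ≈⟨ -‿inverseʳ _ ⟩
      0# ∎

    conclude : AllZero coefficients → s ≈ s′ × p ≈ p′
    conclude (_ ∷ 2[s′-s]≈0 ∷ second≈0 ∷ _) = s≈s′ , p≈p′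
      where
      s≈s′ : s ≈ s′
      s≈s′ = begin
        s              ≈⟨ +-identityʳ s ⟨
        s + 0#         ≈⟨ +-congˡ (*-cancelˡ-0 2≉0 2[s′-s]≈0) ⟨
        s + (s′ - s)   ≈⟨ solve 2 (λ s s′ → s :+ (s′ :- s) := s′) refl s s′ ⟩
        s′             ∎

      p≈p′ : p ≈ p′
      p≈p′ = begin
        p
          ≈⟨ solve 4 (λ s s′ p p′ → p := p′ :+ (s :* s :- s′ :* s′) :- ((s :* s :- p) :- (s′ :* s′ :- p′)))
               refl s s′ p p′ ⟩
        p′ + (s * s - s′ * s′) - ((s * s - p) - (s′ * s′ - p′))
          ≈⟨ +-cong (+-congˡ (+-congʳ (*-cong s≈s′ s≈s′))) (-‿cong second≈0) ⟩
        p′ + (s′ * s′ - s′ * s′) - 0#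
          ≈⟨ solve 2 (λ s p → p :+ (s :* s :- s :* s) :- :0 := p) refl s′ p′ ⟩
        p′ ∎

  -- The expansion of det(I - tA) to second order.

  Det-δ : ∀ {n} → Det (δ {n}) ≈ 1#
  Det-δ {zero}  = Det-empty _
  Det-δ {suc n} = begin
    Det (δ {suc n})
      ≈⟨ trans (Det-suc _) (∑-suc _) ⟩
    1# * 1# * Det (δ {n}) + ∑ (λ j → sgn (suc j) * 0# * Det (λ i k → δ (suc i) (punchIn (suc j) k)))
      ≈⟨ +-cong (*-congˡ Det-δ) (∑-zero λ j → trans (*-congʳ (zeroʳ _)) (zeroˡ _)) ⟩
    1# * 1# * 1# + 0#
      ≈⟨ solve 0 (:1 :* :1 :* :1 :+ :0 := :1) refl ⟩
    1# ∎

  -- Expand `v` in the columns of the identity: each of them except column `j` is repeated among the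
  -- remaining ones.
  Det-∣δ : ∀ {n} (v : Vector Carrier (suc n)) j → Det (v ∣ delete j δ) ≈ sgn j * v j
  Det-∣δ v j = begin
    Det (v ∣ delete j δ)
      ≈⟨ Det-∣-cong (λ i → trans (sym (∑-δ i v)) (∑-cong λ k → *-comm _ _)) (λ _ _ → refl) ⟩
    Det ((λ i → ∑ (λ k → v k * δ i k)) ∣ delete j δ)
      ≈⟨ Det-sum∣ v δ (delete j δ) ⟩
    ∑ (λ k → v k * Det ((λ i → δ i k) ∣ delete j δ))
      ≈⟨ ∑-remove j _ ⟩
    v j * Det ((λ i → δ i j) ∣ delete j δ) + ∑ (λ k → v (punchIn j k) * Det ((λ i → δ i (punchIn j k)) ∣ delete j δ))
      ≈⟨ +-cong (*-congˡ (trans (Det-front j δ) (*-congˡ Det-δ)))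
                (∑-zero λ k → trans (*-congˡ (Det-repeat k (delete j δ))) (zeroʳ _)) ⟩
    v j * (sgn j * 1#) + 0#
      ≈⟨ solve 2 (λ v s → v :* (s :* :1) :+ :0 := s :* v) refl (v j) (sgn j) ⟩
    sgn j * v j ∎

  1-t_ : ∀ {n} → Carrier → Matrix ℝ n → Matrix ℝ n
  (1-t t) A i j = δ i j - t * A i j

  -- The off-diagonal terms in the expansion of det(I - tA) along the first row.
  minorTerm : ∀ {n} → Matrix ℝ (suc n) → Fin n → Carrier → Carrier
  minorTerm A j t = sgn (suc j) * (1-t t) A zero (suc j) * Det (λ i k → (1-t t) A (suc i) (punchIn (suc j) k))

  -- The entry in the first row and the first column of the minor each carry a factor -t, since the
  -- identity has no entry there. What remains is the determinant `F`, and its value at 0 comes from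
  -- `Det-∣δ`.
  minorTerm-expansion : ∀ {n} (A : Matrix ℝ (suc n)) j → ∃ λ g → IsPoly g ×
    (∀ t → minorTerm A j t ≈ - (t * t * (A zero (suc j) * A (suc j) zero + t * g t)))
  minorTerm-expansion {suc n} A j =
    (λ t → sgn j * x * proj₁ split t) , IsPoly-* (IsPoly-const (sgn j * x)) (proj₁ (proj₂ split)) , expansion
    where
    x = A zero (suc j)
    v = λ i → A (suc i) zero
    A′ = λ i k → A (suc i) (suc k)

    F : Carrier → Carrier
    F t = Det (v ∣ delete j ((1-t t) A′))

    F-poly : IsPoly F
    F-poly = IsPoly-Det λ where
      i zero    → IsPoly-const (v i)
      i (suc k) → IsPoly-+ (IsPoly-const _) (IsPoly-neg (IsPoly-* IsPoly-id (IsPoly-const _)))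

    split = IsPoly-split F-poly

    F-0 : F 0# ≈ sgn j * v j
    F-0 = trans
      (Det-∣-cong (λ _ → refl) (λ i k → solve 2 (λ d a → d :- :0 :* a := d) refl (δ i (punchIn j k)) (A′ i (punchIn j k))))
      (Det-∣δ v j)

    expansion : ∀ t → minorTerm A j t ≈ - (t * t * (x * v j + t * (sgn j * x * proj₁ split t)))
    expansion t = begin
      minorTerm A j t
        ≈⟨ *-congˡ (Det-cong λ where
             i zero    → solve 2 (λ t a → :0 :- t :* a := :- t :* a) refl t (v i)
             i (suc k) → refl) ⟩
      sgn (suc j) * (0# - t * x) * Det ((λ i → - t * v i) ∣ delete j ((1-t t) A′))
        ≈⟨ *-congˡ (Det-scale∣ (- t) v (delete j ((1-t t) A′))) ⟩
      sgn (suc j) * (0# - t * x) * (- t * F t)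
        ≈⟨ *-congˡ (*-congˡ (trans (proj₂ (proj₂ split) t) (+-congʳ F-0))) ⟩
      - 1# * sgn j * (0# - t * x) * (- t * (sgn j * v j + t * proj₁ split t))
        ≈⟨ solve 5 (λ s t x v h →
             :- :1 :* s :* (:0 :- t :* x) :* (:- t :* (s :* v :+ t :* h)) :=
             :- (t :* t :* (s :* s :* (x :* v) :+ t :* (s :* x :* h)))) refl (sgn j) t x (v j) (proj₁ split t) ⟩
      - (t * t * (sgn j * sgn j * (x * v j) + t * (sgn j * x * proj₁ split t)))
        ≈⟨ -‿cong (*-congˡ (+-congʳ (trans (*-congʳ (sgn² j)) (*-identityˡ _)))) ⟩
      - (t * t * (x * v j + t * (sgn j * x * proj₁ split t))) ∎

  tr tr² : ∀ {n} → Matrix ℝ n → Carrier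
  tr  A = ∑ (λ i → A i i)
  tr² A = ∑ (λ i → ∑ (λ j → A i j * A j i))

  -- Each entry of the first row off the diagonal meets its mirror entry twice in the trace of the
  -- square; `Expands--` produces the same factor `2#`.
  tr²-suc : ∀ {n} (A : Matrix ℝ (suc n)) →
    A zero zero * A zero zero + tr² (λ i j → A (suc i) (suc j)) + 2# * ∑ (λ j → A zero (suc j) * A (suc j) zero) ≈ tr² A
  tr²-suc A = begin
    d + p + 2# * w
      ≈⟨ solve 3 (λ d p w → d :+ p :+ (:1 :+ :1) :* w := (d :+ w) :+ (w :+ p)) refl d p w ⟩
    (d + w) + (w + p)
      ≈⟨ +-congˡ (+-congʳ (∑-cong λ j → *-comm _ _)) ⟩
    (d + w) + (∑ (λ i → A (suc i) zero * A zero (suc i)) + p)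
      ≈⟨ +-congˡ (∑-distrib-+ _ _) ⟨
    (d + w) + ∑ (λ i → A (suc i) zero * A zero (suc i) + ∑ (λ j → A (suc i) (suc j) * A (suc j) (suc i)))
      ≈⟨ +-cong (∑-suc _) (∑-cong λ i → ∑-suc _) ⟨
    ∑ (λ j → A zero j * A j zero) + ∑ (λ i → ∑ (λ j → A (suc i) j * A j (suc i)))
      ≈⟨ ∑-suc _ ⟨
    tr² A ∎
    where
    d = A zero zero * A zero zero
    p = tr² (λ i j → A (suc i) (suc j))
    w = ∑ (λ j → A zero (suc j) * A (suc j) zero)

  -- Induction along the first row: the diagonal term is handled by `Expands-*`, and all other terms
  -- together are a correction of order 2, handled by `Expands--`.
  Expands-Det : ∀ {n} (A : Matrix ℝ n) → Expands (λ t → Det ((1-t t) A)) (tr A) (tr² A)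
  Expands-Det {zero} A = Expands-cong
    (λ t → sym (Det-empty _)) (sym (∑-empty _)) (sym (∑-empty _)) Expands-1
  Expands-Det {suc n} A = Expands-cong expand (sym (∑-suc _)) (tr²-suc A)
    (Expands-- (∑ w) (Expands-* (A zero zero) (Expands-Det A′)) (IsPoly-∑ (λ j → proj₁ (proj₂ (minorTerm-expansion A j)))))
    where
    A′ = λ i j → A (suc i) (suc j)
    w = λ j → A zero (suc j) * A (suc j) zero
    g = λ j → proj₁ (minorTerm-expansion A j)

    expand : ∀ t → (1# - t * A zero zero) * Det ((1-t t) A′) - t * t * (∑ w + t * ∑ (λ j → g j t)) ≈ Det ((1-t t) A)
    expand t = begin
      (1# - t * A zero zero) * D - t * t * (∑ w + t * ∑ (λ j → g j t))
        ≈⟨ +-cong (*-congʳ (sym (*-identityˡ _))) collect ⟩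
      1# * (1# - t * A zero zero) * D + ∑ (λ j → minorTerm A j t)
        ≈⟨ trans (Det-suc _) (∑-suc _) ⟨
      Det ((1-t t) A) ∎
      where
      D = Det ((1-t t) A′)

      collect : - (t * t * (∑ w + t * ∑ (λ j → g j t))) ≈ ∑ (λ j → minorTerm A j t)
      collect = begin
        - (t * t * (∑ w + t * ∑ (λ j → g j t)))
          ≈⟨ solve 3 (λ t x y → :- (t :* t :* (x :+ t :* y)) := (:- (t :* t)) :* (x :+ t :* y))
               refl t _ _ ⟩
        - (t * t) * (∑ w + t * ∑ (λ j → g j t))
          ≈⟨ *-congˡ (trans (∑-distrib-+ w _) (+-congˡ (sym (*-distribˡ-∑ t (λ j → g j t))))) ⟨
        - (t * t) * ∑ (λ j → w j + t * g j t)
          ≈⟨ *-distribˡ-∑ (- (t * t)) (λ j → w j + t * g j t) ⟩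
        ∑ (λ j → - (t * t) * (w j + t * g j t))
          ≈⟨ ∑-cong (λ j → trans (sym (-‿distribˡ-* (t * t) _)) (sym (proj₂ (proj₂ (minorTerm-expansion A j)) t))) ⟩
        ∑ (λ j → minorTerm A j t) ∎

  -- From the characteristic polynomial to det(I - tA).

  product : List Carrier → Carrier
  product = List.foldr _*_ 1#

  Expands-replicate : ∀ n x → Expands
    (λ t → product (List.map (λ μ → 1# - t * μ) (Vec.toList (Vec.replicate n x)))) (nat n * x) (nat n * (x * x))
  Expands-replicate zero    x = Expands-cong (λ t → refl) (sym (zeroˡ _)) (sym (zeroˡ _)) Expands-1
  Expands-replicate (suc n) x = Expands-cong (λ t → refl) (expand x) (expand (x * x))
    (Expands-* x (Expands-replicate n x))
    where
    expand : ∀ x → x + nat n * x ≈ nat (suc n) * x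
    expand x = solve 2 (λ x n → x :+ n :* x := (:1 :+ n) :* x) refl x (nat n)

  -- Each factor absorbs one `t`, and `t * (x - μ)` is `1# - t * μ`.
  product-reciprocal : ∀ {t x} → t * x ≈ 1# → ∀ (λs : List Carrier) →
    t ^ List.length λs * product (List.map (λ μ → x - μ) λs) ≈ product (List.map (λ μ → 1# - t * μ) λs)
  product-reciprocal tx≈1 [] = *-identityˡ 1#
  product-reciprocal {t} {x} tx≈1 (μ ∷ λs) = begin
    t * t ^ List.length λs * ((x - μ) * product (List.map (λ μ → x - μ) λs))
      ≈⟨ solve 5 (λ t q x μ p → t :* q :* ((x :- μ) :* p) := (t :* x :- t :* μ) :* (q :* p)) refl
           t (t ^ List.length λs) x μ _ ⟩
    (t * x - t * μ) * (t ^ List.length λs * product (List.map (λ μ → x - μ) λs))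
      ≈⟨ *-cong (+-congʳ tx≈1) (product-reciprocal tx≈1 λs) ⟩
    (1# - t * μ) * product (List.map (λ μ → 1# - t * μ) λs) ∎

  Det-reciprocal : ∀ {n} {t x} → t * x ≈ 1# → (A : Matrix ℝ n) → t ^ n * charPoly ℝ A x ≈ Det ((1-t t) A)
  Det-reciprocal {n} {t} {x} tx≈1 A = begin
    t ^ n * charPoly ℝ A x            ≡⟨ ≡.cong (t ^ n *_) (det≡Det _) ⟩
    t ^ n * Det ((x- x) A)            ≈⟨ Det-scale t ((x- x) A) ⟨
    Det (λ i j → t * (x- x) A i j)    ≈⟨ Det-cong (λ i j → trans
        (solve 4 (λ t x d a → t :* (x :* d :- a) := t :* x :* d :- t :* a) refl t x (δ i j) (A i j))
        (+-congʳ (trans (*-congʳ tx≈1) (*-identityˡ _)))) ⟩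
    Det ((1-t t) A)                   ∎

  -- For nonzero `t`, the spectrum evaluated at the inverse of `t` identifies det(I - tA) with the
  -- product of the 1 - tμ. Comparing second-order expansions yields both traces.
  spectrum-traces : ∀ {n} (A : Matrix ℝ (suc n)) x →
                    HasSpectrum ℝ A (0# ∷ Vec.toList (Vec.replicate n x)) →
                    tr A ≈ nat n * x × tr² A ≈ nat n * (x * x)
  spectrum-traces {n} A x spectrum = Expands-unique agree (Expands-Det A)
    (Expands-cong (λ t → refl) (+-identityˡ _) (trans (+-congʳ (zeroˡ 0#)) (+-identityˡ _))
      (Expands-* 0# (Expands-replicate n x)))
    where
    Λ = 0# ∷ Vec.toList (Vec.replicate n x)

    agree : ∀ t → ¬ (t ≈ 0#) → Det ((1-t t) A) ≈ product (List.map (λ μ → 1# - t * μ) Λ)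
    agree t t≉0 with inverse t t≉0
    ... | y , ty≈1 = begin
      Det ((1-t t) A)
        ≈⟨ Det-reciprocal ty≈1 A ⟨
      t ^ suc n * charPoly ℝ A y
        ≈⟨ *-cong (reflexive (≡.cong (λ k → t ^ suc k) (≡.sym (Vec.length-toList (Vec.replicate n x))))) (spectrum y) ⟩
      t ^ List.length Λ * product (List.map (λ μ → y - μ) Λ)
        ≈⟨ product-reciprocal ty≈1 Λ ⟩
      product (List.map (λ μ → 1# - t * μ) Λ) ∎

  δ-refl : ∀ {n} (i : Fin n) → δ i i ≈ 1#
  δ-refl zero    = refl
  δ-refl (suc i) = δ-refl i

  -- Laplacians with all nonzero eigenvalues equal to the number of vertices.

  module _ {n} {G : Graph (suc n)} {A : Matrix ℝ (suc n)} (laplacian : GeneralizedLaplacian ℝ G A) where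

    open GeneralizedLaplacian laplacian

    laplacian-rows : RowSumsZero A
    laplacian-rows i = begin
      ∑ (A i)          ≈⟨ ∑-split i (A i) ⟩
      A i i + S        ≈⟨ +-congʳ (trans (diagonal i) (-‿cong (reflexive (sum≡∑ _)))) ⟩
      - S + S          ≈⟨ -‿inverseˡ S ⟩
      0#               ∎
      where S = ∑ (λ k → if does (k ≟ i) then 0# else A i k)

    private
      ν = nat (suc n)

    -- The difference from νI - J, which has the spectrum {0, ν, …, ν}.
    deviation : Fin (suc n) → Fin (suc n) → Carrier
    deviation i j = A i j - ν * δ i j + 1#

    -- Symmetry turns the squared entries of `A` into `tr² A`, and the zero row sums remove the
    -- products of entries of `A` with 1.
    deviation-sum : ∑ (λ i → ∑ (λ j → deviation i j * deviation i j)) ≈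
                    tr² A + (- (2# * ν)) * tr A + ν * (ν * ν - ν)
    deviation-sum = begin
      ∑ (λ i → ∑ (λ j → deviation i j * deviation i j))
        ≈⟨ ∑-cong row ⟩
      ∑ (λ i → ∑ (λ j → A i j * A j i) + (- (2# * ν)) * A i i + C)
        ≈⟨ ∑-distrib-+ (λ i → ∑ (λ j → A i j * A j i) + (- (2# * ν)) * A i i) (λ _ → C) ⟩
      ∑ (λ i → ∑ (λ j → A i j * A j i) + (- (2# * ν)) * A i i) + ∑ {suc n} (λ _ → C)
        ≈⟨ +-cong (trans (∑-distrib-+ _ _) (+-congˡ (sym (*-distribˡ-∑ (- (2# * ν)) (λ i → A i i))))) (∑-const (suc n) C) ⟩
      tr² A + (- (2# * ν)) * tr A + ν * C ∎
      where
      C = ν * ν - ν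

      row : ∀ i → ∑ (λ j → deviation i j * deviation i j) ≈ ∑ (λ j → A i j * A j i) + (- (2# * ν)) * A i i + C
      row i = begin
        ∑ (λ j → deviation i j * deviation i j)
          -- One `δ i j` is factored out and another stays inside `q`: `∑-δ` then selects the value
          -- at `i`, where the remaining one is 1.
          ≈⟨ ∑-cong (λ j → trans
               (solve 3 (λ a ν d → (a :- ν :* d :+ :1) :* (a :- ν :* d :+ :1) :=
                 a :* a :+ (d :* (ν :* ν :* d :- (:1 :+ :1) :* ν :* a :- (:1 :+ :1) :* ν) :+ ((:1 :+ :1) :* a :+ :1)))
                 refl (A i j) ν (δ i j))
               (+-congʳ (*-congˡ (symmetric i j)))) ⟩
        ∑ (λ j → A i j * A j i + (δ i j * q j + (2# * A i j + 1#)))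
          ≈⟨ trans (∑-distrib-+ _ _) (+-congˡ (trans (∑-distrib-+ _ _) (+-cong (∑-δ i q) (∑-distrib-+ _ _)))) ⟩
        P + (q i + (∑ (λ j → 2# * A i j) + ∑ {suc n} (λ _ → 1#)))
          ≈⟨ +-congˡ (+-cong (+-congʳ (+-congʳ (*-congˡ (δ-refl i))))
               (+-cong (trans (sym (*-distribˡ-∑ 2# (A i))) (*-congˡ (laplacian-rows i))) (∑-const (suc n) 1#))) ⟩
        P + ((ν * ν * 1# - 2# * ν * A i i - 2# * ν) + (2# * 0# + ν * 1#))
          ≈⟨ solve 3 (λ P ν a →
               P :+ ((ν :* ν :* :1 :- (:1 :+ :1) :* ν :* a :- (:1 :+ :1) :* ν) :+ ((:1 :+ :1) :* :0 :+ ν :* :1)) :=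
               P :+ (:- ((:1 :+ :1) :* ν)) :* a :+ (ν :* ν :- ν)) refl P ν (A i i) ⟩
        P + (- (2# * ν)) * A i i + C ∎
        where
        P = ∑ (λ j → A i j * A j i)
        q = λ j → ν * ν * δ i j - 2# * ν * A i j - 2# * ν

    -- Since `nat n` is `ν` minus 1, the three summands are 1, -2 and 1 times `nat n * (ν * ν)`.
    deviation-zero : HasSpectrum ℝ A (0# ∷ Vec.toList (Vec.replicate n ν)) →
                     ∑ (λ i → ∑ (λ j → deviation i j * deviation i j)) ≈ 0#
    deviation-zero spectrum = begin
      ∑ (λ i → ∑ (λ j → deviation i j * deviation i j))
        ≈⟨ deviation-sum ⟩
      tr² A + (- (2# * ν)) * tr A + ν * (ν * ν - ν)
        ≈⟨ +-congʳ (+-cong (proj₂ traces) (*-congˡ (proj₁ traces))) ⟩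
      nat n * (ν * ν) + (- (2# * ν)) * (nat n * ν) + ν * (ν * ν - ν)
        ≈⟨ solve 1 (λ m → let ν = :1 :+ m in
             m :* (ν :* ν) :+ (:- ((:1 :+ :1) :* ν)) :* (m :* ν) :+ ν :* (ν :* ν :- ν) := :0) refl (nat n) ⟩
      0# ∎
      where traces = spectrum-traces A ν spectrum

    -- A missing edge gives a deviation of 1, which would make the sum of squares positive.
    non-edge-absurd : HasSpectrum ℝ A (0# ∷ Vec.toList (Vec.replicate n ν)) →
                      ∀ i j → i ≢ j → ¬ ¬ Graph.Adj G i j
    non-edge-absurd spectrum i j i≢j ¬adj = <-irrefl (sym (deviation-zero spectrum))
      (∑-pos (λ i → ∑-0≤ (λ j → square-0≤ (deviation i j))) i
        (∑-pos (λ j → square-0≤ (deviation i j)) j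
          (<-respʳ (sym (trans (*-cong one one) (*-identityˡ 1#))) 0<1)))
      where
      one : deviation i j ≈ 1#
      one = trans (+-congʳ (+-cong (non-edge i j i≢j ¬adj) (-‿cong (*-congˡ (δ-≢ i≢j)))))
        (solve 1 (λ ν → :0 :- ν :* :0 :+ :1 := :1) refl ν)

  realizable⇒complete : ∀ {n} (G : Graph (suc n)) → EveryPositiveRealizable ℝ G → G ≐ K (suc n)
  realizable⇒complete {n} G realizable i j = mk⇔ (λ adj i≡j → adj-irrefl i≡j adj) adjacent
    where
    open Graph G
    adjacent : i ≢ j → Adj i j
    -- Realizability is tested on the single multiset whose nonzero members all equal the number of
    -- vertices.
    adjacent i≢j with adj? i j | realizable (Vec.replicate n (nat (suc n))) 
           (All.lookup⁻ λ k → <-respʳ (reflexive (≡.sym (Vec.lookup-replicate k _))) (nat-pos n))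
    ... | yes adj | _ = adj
    ... | no ¬adj | A , laplacian , spectrum = contradiction ¬adj (non-edge-absurd laplacian spectrum i j i≢j)

-- Graphs with the edges of the complete graph, and the characterization.

complete⇒connected : ∀ {n} (G : Graph n) → G ≐ K n → Connected G
complete⇒connected G G≐K i j with i ≟ j
... | yes ≡.refl = ε
... | no  i≢j    = Equivalence.from (G≐K i j) i≢j ◅ ε

-- The conditions on a matrix refer to a graph only through its edges, so the same matrix serves
-- both graphs.
complete⇒realizable : ∀ {c ℓ} (ℝ : CompleteOrderedField c ℓ) {n} (G : Graph n) → G ≐ K n →
                      EveryPositiveRealizable ℝ (K n) → EveryPositiveRealizable ℝ G
complete⇒realizable ℝ G G≐K realizable λs pos with realizable λs pos
... | A , laplacian , spectrum = A , record
  { symmetric = symmetric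
  ; edge      = λ i j adj → edge i j (Equivalence.to (G≐K i j) adj)
  ; non-edge  = λ i j i≢j ¬adj → non-edge i j i≢j (¬adj ∘ Equivalence.from (G≐K i j))
  ; diagonal  = diagonal
  } , spectrum
  where open GeneralizedLaplacian laplacian

theorem2p5 : ∀ {c ℓ} (ℝ : CompleteOrderedField c ℓ) (n : ℕ) → 2 ≤ n →
    EveryPositiveRealizable ℝ (K n) ×
    (∀ (G : Graph n) → (Connected G × EveryPositiveRealizable ℝ G) ⇔ (G ≐ K n))
theorem2p5 ℝ (suc n) _ = realizable , λ G → mk⇔
  (λ (_ , G-realizable) → Traces.realizable⇒complete ℝ G G-realizable)
  (λ G≐K → complete⇒connected G G≐K , complete⇒realizable ℝ G G≐K realizable)
  where
  realizable : EveryPositiveRealizable ℝ (K (suc n))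
  realizable = Laplacians.complete-realizable ℝ n
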